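{- Let $h(x)=\sum_{i=0}^{n-1}b_ix^{q^i}\in\mathbb{F}_{q^n}[x]$ be a scattered polynomial. The following are equivalent: (i) $|G_h^\circ|=q^T$ for some $T>1$, and all elements of $G_h$ are diagonal matrices; (ii) $h(x)$ is in standard form. If (i) and (ii) hold, then $T=t_h$ and \[G_h^\circ=\left\{\begin{pmatrix}\alpha&0\\0&\alpha^{q^s}\end{pmatrix}\colon \alpha\in\mathbb{F}_{q^T}\right\},\] where $s$ is the integer with $0\le s<t_h$ such that $h(x)=\sum_{j=0}^{n/t_h-1}c_jx^{q^{s+jt_h}}$ for some $c_j\in\mathbb{F}_{q^n}$ (equivalently, $s$ is the common residue modulo $t_h$ of all $i$ with $b_i\neq0$).
   Context: $q$ is a prime power, $n>1$. A $q$-polynomial $h(x)=\sum_{i=0}^{n-1}b_ix^{q^i}\in\mathbb{F}_{q^n}[x]$ is scattered if for all $y,z\in\mathbb{F}_{q^n}$, $zh(y)-yh(z)=0$ implies $y,z$ are $\mathbb{F}_q$-linearly dependent. $U_h=\{(x,h(x))\colon x\in\mathbb{F}_{q^n}\}$; nonsingular $A$ acts by $(x,y)\mapsto(x,y)A$; $G_h=\{A\in\mathrm{GL}(2,q^n)\colon U_hA=U_h\}$, $G_h^\circ=G_h\cup\{O\}$ ($O$ the zero matrix). Let $\Delta_h=\{(i-j)\bmod n\colon b_ib_j\neq0,\ i\neq j\}\cup\{n\}$ and $t_h=\gcd(\Delta_h)$. $h$ is in standard form if $t_h>1$; in that case $t_h\mid n$ and all exponents $i$ with $b_i\ne0$ are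 congruent modulo $t_h$.
   Formalization: The implication (ii) ⇒ (i) is stated only for n ≠ 2, since it fails at n = 2: x^q over F_{q^2} is scattered and in standard form, yet the swap matrix lies in G_h; the other parts are kept for all n > 1. -}

module Defs where

open import Algebra.Bundles using (CommutativeRing)
import Algebra.Properties.CommutativeMonoid.Sum as Sum
import Algebra.Properties.Semiring.Exp as Exp
open import Data.Bool.Base using (if_then_else_)
open import Data.Fin.Base using (Fin; toℕ)
open import Data.Fin.Patterns using (0F; 1F)
import Data.Fin.Properties as Fin
open import Data.Integer.Base using (_⊖_; _%ℕ_)
open import Data.List.Base as List using (List; allFin; cartesianProduct; filter; foldr; map)
open import Data.Nat.Base as ℕ
  using (ℕ; NonZero; NonTrivial; nonTrivial⇒nonZero; ≢-nonZero; ≢-nonZero⁻¹; _<_; _≤_; _/_)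
open import Data.Nat.GCD using (gcd; gcd[m,n]≢0)
open import Data.Nat.Primality using (Prime)
import Data.Nat.Properties as ℕ
open import Data.Product.Base using (Σ; ∃; ∃₂; _×_; _,_; proj₁)
open import Data.Sum.Base using (inj₁)
open import Data.Vec.Functional using (Vector; []; _∷_)
import Data.Vec.Functional.Relation.Binary.Equality.Setoid as VecEq
open import Function.Bundles using (Inverse)
open import Function.Properties.Inverse using (Inverse⇒Injection)
open import Level using (Level; _⊔_; suc)
open import Relation.Binary.Bundles using (Setoid)
import Relation.Binary.Construct.On as On
open import Relation.Binary.Definitions using (Decidable; _Respects_)
open import Relation.Binary.PropositionalEquality.Core using (_≡_)
open import Relation.Nullary.Decidable.Core using (does; ¬?; _×-dec_)
open import Relation.Nullary.Decidable using (via-injection)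
open import Relation.Nullary.Negation.Core using (¬_)
open import Relation.Unary using (Pred; _∈_; _≐_; _∪_)

IsPrimePower : Pred ℕ _
IsPrimePower q = ∃₂ λ p e → Prime p × 1 ≤ e × q ≡ p ℕ.^ e

module _ {a ℓ} (S : Setoid a ℓ) where

  HasSize : ℕ → Set _
  HasSize N = Inverse S (Fin.≡-setoid N)

  subsetoid : ∀ {p} → Pred (Setoid.Carrier S) p → Setoid _ _
  subsetoid P = On.setoid {B = Σ (Setoid.Carrier S) P} S proj₁

record FiniteField (c ℓ : Level) (N : ℕ) : Set (suc (c ⊔ ℓ)) where
  field
    commutativeRing : CommutativeRing c ℓ
  open CommutativeRing commutativeRing public
  field
    1≉0     : ¬ 1# ≈ 0#
    inverse : ∀ x → ¬ x ≈ 0# → ∃ λ y → x * y ≈ 1#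
    size    : HasSize setoid N

  open Exp semiring public using (_^_)
  open Sum +-commutativeMonoid public using (sum)

  infix 4 _≟_
  _≟_ : Decidable _≈_
  _≟_ = via-injection (Inverse⇒Injection size) Fin._≟_

  record IsSubfield (K : Pred Carrier ℓ) : Set (c ⊔ ℓ) where
    field
      resp      : K Respects _≈_
      0-closed  : 0# ∈ K
      1-closed  : 1# ∈ K
      +-closed  : ∀ {x y} → x ∈ K → y ∈ K → x + y ∈ K
      neg-closed : ∀ {x} → x ∈ K → - x ∈ K
      *-closed  : ∀ {x y} → x ∈ K → y ∈ K → x * y ∈ K
      inv-closed : ∀ {x y} → x ∈ K → x * y ≈ 1# → y ∈ K

  -- A finite field has at most one subfield of each order, so this union over
  -- all subfields of order m is the subfield of order m (empty if there is none).
  𝔽 : ℕ → Pred Carrier (c ⊔ suc ℓ)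
  𝔽 m x = ∃ λ (K : Pred Carrier ℓ) → IsSubfield K × HasSize (subsetoid setoid K) m × x ∈ K

module QPolynomials {c ℓ} (q n : ℕ) .{{_ : NonTrivial n}}
                    (F : FiniteField c ℓ (q ℕ.^ n)) where

  open FiniteField F

  private instance
    n≢0 : NonZero n
    n≢0 = nonTrivial⇒nonZero n

  -- The coefficient family (b₀ , … , bₙ₋₁) of Σᵢ bᵢ x^(qⁱ).
  QPoly : Set c
  QPoly = Fin n → Carrier

  eval : QPoly → Carrier → Carrier
  eval b x = sum λ i → b i * x ^ (q ℕ.^ toℕ i)

  LinearlyDependent : Carrier → Carrier → Set _
  LinearlyDependent y z = ∃₂ λ α β →
    α ∈ 𝔽 q × β ∈ 𝔽 q × ¬ (α ≈ 0# × β ≈ 0#) × α * y + β * z ≈ 0#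

  Scattered : QPoly → Set _
  Scattered h = ∀ y z → z * eval h y - y * eval h z ≈ 0# → LinearlyDependent y z

  Δ : QPoly → List ℕ
  Δ b = n List.∷ map (λ (i , j) → (toℕ i ⊖ toℕ j) %ℕ n)
    (filter (λ (i , j) → ¬? (b i * b j ≟ 0#) ×-dec ¬? (i Fin.≟ j))
      (cartesianProduct (allFin n) (allFin n)))

  t : QPoly → ℕ
  t h = foldr gcd 0 (Δ h)

  instance
    t-nonZero : ∀ {h} → NonZero (t h)
    t-nonZero = ≢-nonZero (gcd[m,n]≢0 n _ (inj₁ (≢-nonZero⁻¹ n)))

  StandardForm : QPoly → Set
  StandardForm h = 1 < t h

  -- a x^(q^k), for k < n, as a coefficient family.
  monomial : Carrier → ℕ → QPoly
  monomial a k i = if does (toℕ i ℕ.≟ k) then a else 0#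

  -- 0 ≤ s < t and h = Σ_{j < n/t} cⱼ x^(q^(s+jt)) as formal polynomials.
  IsShift : QPoly → ℕ → Set _
  IsShift h s = s < t h × ∃ λ (a : Fin (n / t h) → Carrier) →
    ∀ i → h i ≈ sum λ j → monomial (a j) (s ℕ.+ toℕ j ℕ.* t h) i

  Vec₂ : Set c
  Vec₂ = Vector Carrier 2

  Mat₂ : Set c
  Mat₂ = Vector Vec₂ 2

  vecSetoid : Setoid _ _
  vecSetoid = VecEq.≋-setoid setoid 2

  matSetoid : Setoid _ _
  matSetoid = VecEq.≋-setoid vecSetoid 2

  open Setoid vecSetoid using () renaming (_≈_ to _≈ᵥ_)
  open Setoid matSetoid using () renaming (_≈_ to _≈ₘ_)

  infixl 7 _·_
  _·_ : Vec₂ → Mat₂ → Vec₂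
  (v · A) j = sum λ i → v i * A i j

  det : Mat₂ → Carrier
  det A = A 0F 0F * A 1F 1F - A 0F 1F * A 1F 0F

  diag : Carrier → Carrier → Mat₂
  diag α β = (α ∷ 0# ∷ []) ∷ (0# ∷ β ∷ []) ∷ []

  IsDiagonal : Mat₂ → Set _
  IsDiagonal A = ∀ i j → ¬ i ≡ j → A i j ≈ 0#

  U : QPoly → Pred Vec₂ _
  U h v = ∃ λ x → v ≈ᵥ (x ∷ eval h x ∷ [])

  image : ∀ {p} → Pred Vec₂ p → Mat₂ → Pred Vec₂ _
  image P A v = ∃ λ w → w ∈ P × v ≈ᵥ w · A

  G : QPoly → Pred Mat₂ _
  G h A = ¬ det A ≈ 0# × image (U h) A ≐ U h

  G° : QPoly → Pred Mat₂ _
  G° h = G h ∪ (_≈ₘ diag 0# 0#)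

  -- Standard form does not imply this when n = 2: the polynomial x^q is scattered and
  -- in standard form, but (x , x^q) ↦ (x^q , x) preserves its graph.
  DiagonalStabilizer : QPoly → ℕ → Set _
  DiagonalStabilizer h T =
    1 < T × HasSize (subsetoid matSetoid (G° h)) (q ℕ.^ T) × (∀ A → A ∈ G h → IsDiagonal A)

  DiagonalField : ℕ → ℕ → Pred Mat₂ _
  DiagonalField T s A = ∃ λ α → α ∈ 𝔽 (q ℕ.^ T) × A ≈ₘ diag α (α ^ (q ℕ.^ s))

{-# OPTIONS --safe #-}

-- If h is scattered, a matrix diag(α , β) preserves the graph of h exactly when h(αx) = β h(x)
-- for all x; comparing coefficients, α lies in the field of order q^t and β = α^(q^s). So as
-- soon as all stabilizing matrices are diagonal, G° is in bijection with that field and T = t.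
--
-- Conversely let t > 1. Then s ≠ 0, since otherwise h would be linear over a field larger than
-- F_q. For a stabilizing matrix with rows (a , b) and (c , d) one has
-- h(ax) + h(ch(x)) = bx + dh(x), and h(ch(x)) = bx follows by twisting x with the field of order
-- q^t. If c ≠ 0, then for some α the map x ↦ αx + ch(x) takes values in a single eigenspace
-- of h: for b = 0 take α = 0, and for b ≠ 0 take α of norm bc. By scatteredness its image and its
-- kernel are at most one-dimensional over F_q, so n ≤ 2.
module Submission where

open import Algebra.Bundles using (CommutativeMonoid)
import Algebra.Properties.AbelianGroup as GroupProperties
import Algebra.Properties.CommutativeMonoid.Sum as CommutativeMonoidSum
import Algebra.Properties.CommutativeSemiring.Binomial as Binomial
import Algebra.Properties.CommutativeSemiring.Exp as Exp
import Algebra.Properties.Ring as RingProperties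
import Algebra.Properties.Semiring.Mult as Mult
import Algebra.Properties.Semiring.Sum as SemiringSum
import Algebra.Solver.Ring.NaturalCoefficients.Default as Solver
open import Data.Bool.Base using (if_then_else_)
open import Data.Fin.Base using (Fin; zero; suc; toℕ; fromℕ; remQuot; combine; fromℕ<; inject₁)
open import Data.Fin.Patterns using (0F; 1F)
open import Data.Fin.Permutation using (permutation)
import Data.Fin.Properties as Fin
open import Data.Fin.Relation.Unary.Top using (view; ‵fromℕ; ‵inject₁)
open import Data.Integer.Base using (_⊖_; _%ℕ_)
import Data.Integer.Properties as ℤ
open import Data.List.Base using ([]; _∷_; foldr; allFin; cartesianProduct)
open import Data.List.Membership.Propositional using () renaming (_∈_ to _∈ₗ_)
open import Data.List.Membership.Propositional.Properties
  using (∈-map⁺; ∈-filter⁺; ∈-cartesianProduct⁺; ∈-allFin)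
open import Data.List.Relation.Unary.All as All using (All; []; _∷_)
import Data.List.Relation.Unary.All.Properties as All
open import Data.List.Relation.Unary.Any using (here; there)
open import Data.Nat.Base as ℕ using (ℕ; zero; suc; NonZero; _!; s≤s; z≤n; NonTrivial)
open import Data.Nat.Combinatorics using (_C_; nCk≡n!/k![n-k]!; k![n∸k]!∣n!; nCn≡1)
open import Data.Nat.DivMod
  using (m/n*n≡m; _%_; _/_; m≡m%n+[m/n]*n; m%n<n; [m+kn]%n≡m%n; m<n⇒m%n≡m; m/n*n≤m)
open import Data.Nat.Divisibility using (_∣_; divides; ∣⇒≤; ∣-trans; ∣-refl)
open import Data.Nat.GCD using (gcd; gcd-GCD; module Bézout; gcd[m,n]∣m; gcd[m,n]∣n)
open import Data.Nat.Primality using (Prime; euclidsLemma; prime⇒nonZero; prime⇒nonTrivial)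
import Data.Nat.Properties as ℕ
open import Data.Nat.Solver using (module +-*-Solver)
open import Data.Product using (Σ; ∃; ∃₂; _×_; _,_; proj₁; proj₂; ∃!)
open import Data.Sum.Base using (_⊎_; inj₁; inj₂)
open import Data.Sum.Base as Sum using (_⊎_; inj₁; inj₂)
open import Data.Unit.Polymorphic.Base using (⊤; tt)
open import Data.Vec.Functional using (replicate; removeAt)
open import Defs
open import Function.Base using (_∘_; id)
open import Function.Bundles using (Inverse)
import Function.Construct.Composition as Composition
import Function.Construct.Identity as Identity
open import Level using (_⊔_)
open import Relation.Binary.Bundles using (Setoid)
open import Relation.Binary.Definitions using (_Respects_)
import Relation.Binary.PropositionalEquality as ≡
open ≡ using (_≡_; _≢_)
open import Relation.Nullary using (¬_; yes; no; contradiction; Dec; ¬?; _×-dec_; map′)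
open import Relation.Nullary.Decidable using (dec-true; dec-false; decidable-stable; toSum)
open import Relation.Unary using (Pred; Decidable; ∁; _∈_; _≐_)

-- `F` is given only as a field with q^n elements, so its structure has to come from counting.
-- Subfields are handled as fixed sets of Frobenius powers. One estimate, `power-count`, serves
-- twice: it bounds the number of solutions of x^(M+1) = w x from below, by bounding the
-- non-solutions from above as roots of a cofactor. With w = 1 it gives the order of a fixed field,
-- with w = bc the surjectivity of a norm. Dimension over F_q is replaced by counting as well: if
-- the image and the kernel of an additive map each lie on a line, every element of the field is a
-- combination of two fixed ones, whence q^n ≤ q^2. Eigenspaces of h are the target because h(y) = κ
-- y and h(z) = κ z imply z h(y) = y h(z), which is exactly the equation that scatteredness
-- restricts.

module _ {a ℓ} (S : Setoid a ℓ) {N} (size : HasSize S N) where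
  open Setoid S
  open Inverse size

  to-injective : ∀ {x y} → to x ≡ to y → x ≈ y
  to-injective {x} {y} eq = trans (sym (strictlyInverseʳ x)) (trans (from-cong eq) (strictlyInverseʳ y))

  from-injective : ∀ {i j} → from i ≈ from j → i ≡ j
  from-injective {i} {j} eq =
    ≡.trans (≡.sym (strictlyInverseˡ i)) (≡.trans (to-cong eq) (strictlyInverseˡ j))

module _ {a ℓ b m} (S : Setoid a ℓ) (T : Setoid b m) where
  private
    module S = Setoid S
    module T = Setoid T

  size-≤ : ∀ {M N} → HasSize S M → HasSize T N → (f : S.Carrier → T.Carrier) →
           (∀ {x y} → f x T.≈ f y → x S.≈ y) → M ℕ.≤ N
  size-≤ sizeS sizeT f f-injective = Fin.injective⇒≤ {f = λ i → Inverse.to sizeT (f (Inverse.from sizeS i))}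
    λ eq → from-injective S sizeS (f-injective (to-injective T sizeT eq))

  size-≤-surjective : ∀ {M N} → HasSize S M → HasSize T N → (f : S.Carrier → T.Carrier) →
           (∀ {x y} → x S.≈ y → f x T.≈ f y) → (∀ y → ∃ λ x → f x T.≈ y) → N ℕ.≤ M
  size-≤-surjective sizeS sizeT f f-cong f-onto = Fin.injective⇒≤
    {f = λ j → Inverse.to sizeS (proj₁ (f-onto (Inverse.from sizeT j)))}
    λ {i} {j} eq → from-injective T sizeT (T.trans (T.sym (proj₂ (f-onto _)))
      (T.trans (f-cong (to-injective S sizeS eq)) (proj₂ (f-onto _))))

-- Enumerations of decidable subsets

record Enumeration {N p} (P : Pred (Fin N) p) (k : ℕ) : Set p where
  field
    index     : Fin k → Fin N
    injective : ∀ {i j} → index i ≡ index j → i ≡ j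
    sound     : ∀ i → P (index i)
    complete  : ∀ j → P j → ∃ λ i → index i ≡ j

module _ {N p} {P : Pred (Fin (suc N)) p} {k} (e : Enumeration (P ∘ suc) k) where
  open Enumeration e

  include-zero : P zero → Enumeration P (suc k)
  include-zero P0 = record
    { index     = λ { zero → zero ; (suc i) → suc (index i) }
    ; injective = λ { {zero} {zero} _ → ≡.refl
                    ; {suc i} {suc j} eq → ≡.cong suc (injective (Fin.suc-injective eq)) }
    ; sound     = λ { zero → P0 ; (suc i) → sound i }
    ; complete  = λ { zero _ → zero , ≡.refl
                    ; (suc j) Pj → let i , eq = complete j Pj in suc i , ≡.cong suc eq }
    }

  exclude-zero : ¬ P zero → Enumeration P k
  exclude-zero ¬P0 = record
    { index     = suc ∘ index
    ; injective = injective ∘ Fin.suc-injective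
    ; sound     = sound
    ; complete  = λ { zero P0 → contradiction P0 ¬P0
                    ; (suc j) Pj → let i , eq = complete j Pj in i , ≡.cong suc eq }
    }

-- The set and its complement are enumerated together, because `power-count` bounds the size of the
-- one from below by bounding that of the other from above.
enumerate-partition : ∀ {N p} {P : Pred (Fin N) p} → Decidable P →
  ∃₂ λ k k′ → k ℕ.+ k′ ≡ N × Enumeration P k × Enumeration (∁ P) k′
enumerate-partition {zero} P? = 0 , 0 , ≡.refl , empty , empty
  where
  empty : ∀ {p} {P : Pred (Fin 0) p} → Enumeration P 0
  empty = record { index = id ; injective = λ {} ; sound = λ () ; complete = λ () }
enumerate-partition {suc N} {P = P} P? with enumerate-partition (P? ∘ suc) | P? zero
... | k , k′ , eq , e , e′ | yes P0 =
  suc k , k′ , ≡.cong suc eq , include-zero e P0 , exclude-zero e′ (λ ¬P0 → ¬P0 P0)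
... | k , k′ , eq , e , e′ | no ¬P0 =
  k , suc k′ , ≡.trans (ℕ.+-suc k k′) (≡.cong suc eq) , exclude-zero e ¬P0 , include-zero e′ ¬P0

module _ {a ℓ} (S : Setoid a ℓ) {N} (size : HasSize S N) where
  open Setoid S
  open Inverse size

  enumeration-size : ∀ {p} {P : Pred Carrier p} {k} → P Respects _≈_ →
                     Enumeration (P ∘ from) k → HasSize (subsetoid S P) k
  enumeration-size {P = P} resp e = record
    { to        = rank
    ; from      = λ i → from (index i) , sound i
    ; to-cong   = λ {x} {y} x≈y → injective (from-injective S size
                    (trans (rank-from x) (trans x≈y (sym (rank-from y)))))
    ; from-cong = λ { ≡.refl → refl }
    ; inverse   = (λ {i} {x} x≈ → injective (from-injective S size (trans (rank-from x) x≈)))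
                , (λ { {x} ≡.refl → rank-from x })
    }
    where
    open Enumeration e
    find : ∀ ((x , _) : Σ Carrier P) → ∃ λ i → index i ≡ to x
    find (x , Px) = complete (to x) (resp (sym (strictlyInverseʳ x)) Px)
    rank = proj₁ ∘ find
    rank-from : ∀ (x : Σ Carrier P) → from (index (rank x)) ≈ proj₁ x
    rank-from x = trans (from-cong (proj₂ (find x))) (strictlyInverseʳ (proj₁ x))

  partition-size : ∀ {p} {P : Pred Carrier p} → P Respects _≈_ → Decidable P →
    ∃₂ λ k k′ → k ℕ.+ k′ ≡ N × HasSize (subsetoid S P) k × HasSize (subsetoid S (∁ P)) k′
  partition-size resp P? =
    let k , k′ , eq , e , e′ = enumerate-partition (P? ∘ from)
    in k , k′ , eq , enumeration-size resp e ,
       enumeration-size (λ x≈y ¬Px Py → ¬Px (resp (sym x≈y) Py)) e′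

-- Sums with at most one nontrivial term, and binomial coefficients modulo a prime.

module _ {a ℓ} (M : CommutativeMonoid a ℓ) where
  open CommutativeMonoid M
  open CommutativeMonoidSum M
  open import Relation.Binary.Reasoning.Setoid setoid

  sum-≈ε : ∀ {m} {f : Fin m → Carrier} → (∀ i → f i ≈ ε) → sum f ≈ ε
  sum-≈ε {m} f≈ε = trans (sum-cong-≋ f≈ε) (sum-replicate-zero m)

  sum-single : ∀ {m} {f : Fin m → Carrier} i → (∀ j → j ≢ i → f j ≈ ε) → sum f ≈ f i
  sum-single {suc m} {f} i f≈ε = begin
    sum f                        ≈⟨ sum-remove f ⟩
    f i ∙ sum (removeAt f i)     ≈⟨ ∙-congˡ (sum-≈ε λ j → f≈ε _ (Fin.punchInᵢ≢i i j)) ⟩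
    f i ∙ ε                      ≈⟨ identityʳ _ ⟩
    f i                          ∎

prime∤! : ∀ {p} → Prime p → ∀ k → k ℕ.< p → ¬ p ∣ k !
prime∤! pr zero k<p p∣ = ℕ.≤⇒≯ (∣⇒≤ p∣) (ℕ.nonTrivial⇒n>1 _ {{prime⇒nonTrivial pr}})
prime∤! pr (suc k) k<p p∣ with euclidsLemma (suc k) (k !) pr p∣
... | inj₁ p∣1+k = ℕ.<⇒≱ k<p (∣⇒≤ p∣1+k)
... | inj₂ p∣k!  = prime∤! pr k (ℕ.<-trans (ℕ.n<1+n k) k<p) p∣k!

-- p divides p! = (p C k) · k! · (p - k)!, but neither of the two smaller factorials.
prime∣C : ∀ {p} → Prime p → ∀ k → 0 ℕ.< k → k ℕ.< p → p ∣ (p C k)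
prime∣C {p} pr k 0<k k<p with euclidsLemma (p C k) (k ! ℕ.* (p ℕ.∸ k) !) pr p∣product
  where
  instance
    denominator≢0 = k ℕ.!* (p ℕ.∸ k) !≢0
  product≡p! : (p C k) ℕ.* (k ! ℕ.* (p ℕ.∸ k) !) ≡ p !
  product≡p! = ≡.trans
    (≡.cong (ℕ._* (k ! ℕ.* (p ℕ.∸ k) !)) (nCk≡n!/k![n-k]! (ℕ.<⇒≤ k<p)))
    (m/n*n≡m (k![n∸k]!∣n! (ℕ.<⇒≤ k<p)))
  p∣p! : ∀ m → .{{NonZero m}} → m ∣ m !
  p∣p! (suc m) = divides (m !) (ℕ.*-comm (suc m) (m !))
  p∣product : p ∣ (p C k) ℕ.* (k ! ℕ.* (p ℕ.∸ k) !)
  p∣product = ≡.subst (p ∣_) (≡.sym product≡p!) (p∣p! p {{prime⇒nonZero pr}})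
... | inj₁ p∣C = p∣C
... | inj₂ p∣! with euclidsLemma (k !) ((p ℕ.∸ k) !) pr p∣!
...   | inj₁ p∣k! = contradiction p∣k! (prime∤! pr k k<p)
...   | inj₂ p∣[p-k]! = contradiction p∣[p-k]!
          (prime∤! pr (p ℕ.∸ k) (ℕ.∸-monoʳ-< 0<k (ℕ.<⇒≤ k<p)))

-- Finite fields: root counting, Fermat's identity, characteristic and Frobenius.

module FieldProperties {c ℓ N} (F : FiniteField c ℓ N) where
  open FiniteField F hiding (zero)
  open RingProperties ring using (-‿distribˡ-*)
  open GroupProperties +-abelianGroup using (x∙y⁻¹≈ε⇒x≈y; x≈y⇒x∙y⁻¹≈ε; ∙-cancelʳ)
  open Exp commutativeSemiring using (^-congˡ; ^-assocʳ)
  open Mult semiring using (×-congʳ; ×1-homo-*; ×-assoc-*) renaming (_×_ to _×#_)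
  open CommutativeMonoidSum +-commutativeMonoid
    using (sum-cong-≋; ∑-distrib-+; sum-permute; sum-replicate; sum-init-last)
  module ∏ = CommutativeMonoidSum *-commutativeMonoid
  open import Relation.Binary.Reasoning.Setoid setoid
  private
    module R = Solver commutativeSemiring
    open R using (_:+_; _:*_; _:=_)

  *-zero-product : ∀ {x y} → x * y ≈ 0# → x ≈ 0# ⊎ y ≈ 0#
  *-zero-product {x} {y} xy≈0 with x ≟ 0#
  ... | yes x≈0 = inj₁ x≈0
  ... | no x≉0 = let z , xz≈1 = inverse x x≉0 in inj₂ (begin
    y             ≈⟨ *-identityˡ y ⟨
    1# * y        ≈⟨ *-congʳ xz≈1 ⟨
    (x * z) * y   ≈⟨ R.solve 3 (λ x z y → (x :* z) :* y := z :* (x :* y)) refl x z y ⟩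
    z * (x * y)   ≈⟨ *-congˡ xy≈0 ⟩
    z * 0#        ≈⟨ zeroʳ z ⟩
    0#            ∎)

  *-≉0 : ∀ {x y} → ¬ x ≈ 0# → ¬ y ≈ 0# → ¬ x * y ≈ 0#
  *-≉0 x≉0 y≉0 xy≈0 with *-zero-product xy≈0
  ... | inj₁ x≈0 = x≉0 x≈0
  ... | inj₂ y≈0 = y≉0 y≈0

  *-cancelʳ-⊎ : ∀ {x y} z → x * z ≈ y * z → x ≈ y ⊎ z ≈ 0#
  *-cancelʳ-⊎ {x} {y} z xz≈yz with *-zero-product {x - y} {z} (begin
    (x - y) * z         ≈⟨ distribʳ z x (- y) ⟩
    x * z + - y * z     ≈⟨ +-congˡ (-‿distribˡ-* y z) ⟨
    x * z + - (y * z)   ≈⟨ x≈y⇒x∙y⁻¹≈ε xz≈yz ⟩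
    0#                  ∎)
  ... | inj₁ x-y≈0 = inj₁ (x∙y⁻¹≈ε⇒x≈y x y x-y≈0)
  ... | inj₂ z≈0   = inj₂ z≈0

  *-cancelʳ : ∀ {x y} z → ¬ z ≈ 0# → x * z ≈ y * z → x ≈ y
  *-cancelʳ z z≉0 xz≈yz with *-cancelʳ-⊎ z xz≈yz
  ... | inj₁ x≈y = x≈y
  ... | inj₂ z≈0 = contradiction z≈0 z≉0

  *-cancelˡ : ∀ {x y} z → ¬ z ≈ 0# → z * x ≈ z * y → x ≈ y
  *-cancelˡ z z≉0 zx≈zy = *-cancelʳ z z≉0 (trans (*-comm _ z) (trans zx≈zy (*-comm z _)))

  ^-≉0 : ∀ {x} k → ¬ x ≈ 0# → ¬ x ^ k ≈ 0#
  ^-≉0 zero    x≉0 = 1≉0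
  ^-≉0 (suc k) x≉0 = *-≉0 x≉0 (^-≉0 k x≉0)

  0^ : ∀ k → 0 ℕ.< k → 0# ^ k ≈ 0#
  0^ (suc k) _ = zeroˡ _

  1^ : ∀ k → 1# ^ k ≈ 1#
  1^ zero    = refl
  1^ (suc k) = trans (*-identityˡ _) (1^ k)

  _≉?0 : ∀ x → x ≈ 0# ⊎ ¬ x ≈ 0#
  x ≉?0 with x ≟ 0#
  ... | yes x≈0 = inj₁ x≈0
  ... | no x≉0 = inj₂ x≉0

  ×#-* : ∀ k x → k ×# x ≈ (k ×# 1#) * x
  ×#-* k x = trans (×-congʳ k (sym (*-identityˡ x))) (sym (×-assoc-* k 1# x))

  -- The leading coefficient a may vanish: d is only a formal degree.
  data Poly (a : Carrier) : ℕ → (Carrier → Carrier) → Set (c ⊔ ℓ) where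
    constant : ∀ {f} → (∀ x → f x ≈ a) → Poly a 0 f
    horner   : ∀ {f d} g b → Poly a d g → (∀ x → f x ≈ x * g x + b) → Poly a (suc d) f

  Poly-resp : ∀ {a b d f g} → a ≈ b → (∀ x → f x ≈ g x) → Poly a d f → Poly b d g
  Poly-resp a≈b f≈g (constant f≈a) = constant λ x → trans (sym (f≈g x)) (trans (f≈a x) a≈b)
  Poly-resp a≈b f≈g (horner h b p f≈) =
    horner h b (Poly-resp a≈b (λ _ → refl) p) λ x → trans (sym (f≈g x)) (f≈ x)

  Poly-scale : ∀ {a d f} r → Poly a d f → Poly (r * a) d (λ x → r * f x)
  Poly-scale r (constant f≈a) = constant λ x → *-congˡ (f≈a x)
  Poly-scale {f = f} r (horner g b p f≈) = horner (λ x → r * g x) (r * b) (Poly-scale r p) λ x → begin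
    r * f x               ≈⟨ *-congˡ (f≈ x) ⟩
    r * (x * g x + b)     ≈⟨ R.solve 4 (λ r x g b → r :* (x :* g :+ b) := x :* (r :* g) :+ r :* b)
                               refl r x (g x) b ⟩
    x * (r * g x) + r * b ∎

  -- With e < d the leading coefficient is that of the first summand, so no cancellation at the top
  -- has to be excluded.
  Poly-add-lower : ∀ {a b d e f g} → Poly a d f → Poly b e g → e ℕ.< d → Poly a d (λ x → f x + g x)
  Poly-add-lower {b = b} {f = f} {g} (horner f′ β p f≈) (constant g≈) _ =
    horner f′ (β + b) p λ x → begin
      f x + g x             ≈⟨ +-cong (f≈ x) (g≈ x) ⟩
      (x * f′ x + β) + b    ≈⟨ +-assoc _ _ _ ⟩
      x * f′ x + (β + b)    ∎
  Poly-add-lower {f = f} {g} (horner f′ β p f≈) (horner g′ γ p′ g≈) (s≤s e<d) =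
    horner (λ x → f′ x + g′ x) (β + γ) (Poly-add-lower p p′ e<d) λ x → begin
      f x + g x                             ≈⟨ +-cong (f≈ x) (g≈ x) ⟩
      (x * f′ x + β) + (x * g′ x + γ)       ≈⟨ R.solve 5 (λ x f g β γ →
           (x :* f :+ β) :+ (x :* g :+ γ) := x :* (f :+ g) :+ (β :+ γ)) refl x (f′ x) (g′ x) β γ ⟩
      x * (f′ x + g′ x) + (β + γ)           ∎

  Poly-shift : ∀ {a d f} m → Poly a d f → Poly a (m ℕ.+ d) (λ x → x ^ m * f x)
  Poly-shift zero    p = Poly-resp refl (λ x → sym (*-identityˡ _)) p
  Poly-shift {f = f} (suc m) p = horner (λ x → x ^ m * f x) 0# (Poly-shift m p) λ x →
    trans (*-assoc x (x ^ m) (f x)) (sym (+-identityʳ _))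

  Poly-^ : ∀ m → Poly 1# m (_^ m)
  Poly-^ m = ≡.subst (λ d → Poly 1# d (_^ m)) (ℕ.+-identityʳ m)
    (Poly-resp refl (λ x → *-identityʳ _) (Poly-shift {f = λ _ → 1#} m (constant λ _ → refl)))

  -- The identity f x − f r = (x − r) g x with both sides moved so that no subtraction occurs.
  Poly-divide : ∀ {a d f} → Poly a (suc d) f → ∀ r →
                ∃ λ g → Poly a d g × (∀ x → f x + r * g x ≈ x * g x + f r)
  Poly-divide {f = f} (horner g b p@(constant g≈a) f≈) r = g , p , λ x → begin
    f x + r * g x             ≈⟨ +-congʳ (f≈ x) ⟩
    (x * g x + b) + r * g x   ≈⟨ +-congˡ (*-congˡ (trans (g≈a x) (sym (g≈a r)))) ⟩
    (x * g x + b) + r * g r   ≈⟨ R.solve 3 (λ u b v → (u :+ b) :+ v := u :+ (v :+ b)) refl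
                                    (x * g x) b (r * g r) ⟩
    x * g x + (r * g r + b)   ≈⟨ +-congˡ (f≈ r) ⟨
    x * g x + f r             ∎
  Poly-divide {f = f} (horner g b p@(horner _ _ _ _) f≈) r =
    -- As x g(x) - r g(r) = (x - r) g(x) + r (g(x) - g(r)), a quotient q for g yields the quotient g
    -- + r q for f.
    let q , p′ , g≈ = Poly-divide p r in
    (λ x → g x + r * q x) , Poly-add-lower p (Poly-scale r p′) ℕ.≤-refl , λ x → begin
      f x + r * (g x + r * q x)                   ≈⟨ +-cong (f≈ x) (*-congˡ (g≈ x)) ⟩
      (x * g x + b) + r * (x * q x + g r)         ≈⟨ R.solve 6 (λ x g b r q gr →
        (x :* g :+ b) :+ r :* (x :* q :+ gr) := x :* (g :+ r :* q) :+ (r :* gr :+ b))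
        refl x (g x) b r (q x) (g r) ⟩
      x * (g x + r * q x) + (r * g r + b)         ≈⟨ +-congˡ (f≈ r) ⟨
      x * (g x + r * q x) + f r                   ∎

  -- Division by x - r keeps the leading coefficient `a`, so the induction on the degree ends at a
  -- nonzero constant, which has no root.
  root-bound : ∀ {a d f} → ¬ a ≈ 0# → Poly a d f → ∀ {k} (r : Fin k → Carrier) →
               (∀ {i j} → r i ≈ r j → i ≡ j) → (∀ i → f (r i) ≈ 0#) → k ℕ.≤ d
  root-bound a≉0 p {zero} r r-injective roots = z≤n
  root-bound a≉0 (constant f≈a) {suc k} r r-injective roots =
    contradiction (trans (sym (f≈a (r zero))) (roots zero)) a≉0
  root-bound {f = f} a≉0 p@(horner _ _ _ _) {suc k} r r-injective roots =
    let g , p′ , f≈ = Poly-divide p (r zero) in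
    s≤s (root-bound a≉0 p′ (r ∘ suc) (Fin.suc-injective ∘ r-injective) λ i →
      g-root g (r (suc i)) (f≈ (r (suc i))) (roots (suc i)) (λ eq → Fin.0≢1+n (≡.sym (r-injective eq))))
    where
    g-root : ∀ g x → f x + r zero * g x ≈ x * g x + f (r zero) → f x ≈ 0# → ¬ x ≈ r zero → g x ≈ 0#
    g-root g x eq fx≈0 x≉r with *-cancelʳ-⊎ (g x) (begin
        x * g x                  ≈⟨ +-identityʳ _ ⟨
        x * g x + 0#             ≈⟨ +-congˡ (roots zero) ⟨
        x * g x + f (r zero)     ≈⟨ eq ⟨
        f x + r zero * g x       ≈⟨ +-congʳ fx≈0 ⟩
        0# + r zero * g x        ≈⟨ +-identityˡ _ ⟩
        r zero * g x             ∎)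
    ... | inj₁ x≈r  = contradiction x≈r x≉r
    ... | inj₂ gx≈0 = gx≈0

  geometric : Carrier → ℕ → Carrier → Carrier
  geometric w zero    y = 1#
  geometric w (suc m) y = y * geometric w m y + w ^ suc m

  -- (y − w) (yᵐ + yᵐ⁻¹ w + ⋯ + wᵐ) = yᵐ⁺¹ − wᵐ⁺¹, again without subtraction.
  geometric-sum : ∀ w m y → y * geometric w m y + w ^ suc m ≈ w * geometric w m y + y ^ suc m
  geometric-sum w zero    y = R.solve 2 (λ y w →
    y :* R.con 1 :+ w :* R.con 1 := w :* R.con 1 :+ y :* R.con 1) refl y w
  geometric-sum w (suc m) y = begin
    y * (y * g + w ^ suc m) + w * w ^ suc m    ≈⟨ +-congʳ (*-congˡ (geometric-sum w m y)) ⟩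
    y * (w * g + y ^ suc m) + w * w ^ suc m    ≈⟨ R.solve 5 (λ y w g u v →
      y :* (w :* g :+ u) :+ w :* v := w :* (y :* g :+ v) :+ y :* u) refl y w g (y ^ suc m) (w ^ suc m) ⟩
    w * (y * g + w ^ suc m) + y * y ^ suc m    ∎
    where g = geometric w m y

  geometric-Poly : ∀ w m M → 0 ℕ.< M → Poly 1# (m ℕ.* M) (λ x → geometric w m (x ^ M))
  geometric-Poly w zero    M M>0 = constant λ _ → refl
  geometric-Poly w (suc m) M M>0 =
    Poly-add-lower (Poly-shift M (geometric-Poly w m M M>0)) (constant {f = λ _ → w ^ suc m} λ _ → refl)
      (ℕ.<-≤-trans M>0 (ℕ.m≤m+n M _))

  geometric-root : ∀ {w m y} → y ^ suc m ≈ w ^ suc m → ¬ y ≈ w → geometric w m y ≈ 0#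
  geometric-root {w} {m} {y} eq y≉w with *-cancelʳ-⊎ (geometric w m y)
    (∙-cancelʳ (w ^ suc m) _ _ (trans (geometric-sum w m y) (+-congˡ eq)))
  ... | inj₁ y≈w = contradiction y≈w y≉w
  ... | inj₂ g≈0 = g≈0

  root-bound-size : ∀ {a ℓ′} {S : Setoid a ℓ′} (let module S = Setoid S) (g : S.Carrier → Carrier) →
    (∀ {x y} → g x ≈ g y → x S.≈ y) → ∀ {a d f} → ¬ a ≈ 0# → Poly a d f → ∀ {k} → HasSize S k →
    (∀ x → f (g x) ≈ 0#) → k ℕ.≤ d
  root-bound-size {S = S} g g-injective a≉0 p size roots = root-bound a≉0 p (g ∘ Inverse.from size)
    (from-injective S size ∘ g-injective) (roots ∘ Inverse.from size)

  -- The x ∈ S with x^(M+1) ≠ w x are roots of the cofactor of x^M − w in x^(M(m+1)) − w^(m+1).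
  power-count : ∀ {a ℓ′} {S : Setoid a ℓ′} (let module S = Setoid S) (g : S.Carrier → Carrier) →
    (∀ {x y} → x S.≈ y → g x ≈ g y) → (∀ {x y} → g x ≈ g y → x S.≈ y) →
    ∀ {L} → HasSize S L → ∀ {M m w} → 0 ℕ.< M → w ^ suc m ≈ 1# →
    (∀ x → g x ^ (M ℕ.* suc m) * g x ≈ g x) →
    ∃ λ k → HasSize (subsetoid S (λ x → g x ^ M * g x ≈ w * g x)) k × L ℕ.≤ k ℕ.+ m ℕ.* M
  power-count {S = S} g g-cong g-injective {L} size {M} {m} {w} M>0 w^≈1 g^ =
    let k , k′ , k+k′≡L , sizeP , size∁P = partition-size S size P-resp (λ x → g x ^ M * g x ≟ w * g x)
    in k , sizeP , ℕ.≤-trans (ℕ.≤-reflexive (≡.sym k+k′≡L)) (ℕ.+-monoʳ-≤ k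
         (root-bound-size {S = subsetoid S (∁ P)} (g ∘ proj₁) g-injective 1≉0
           (geometric-Poly w m M M>0) size∁P λ (x , ¬Px) → root x ¬Px))
    where
    module S = Setoid S
    -- The factor `g x` on both sides makes 0 a solution, so that the complement involves nonzero
    -- values only and `g x` can be cancelled there.
    P : Pred S.Carrier _
    P x = g x ^ M * g x ≈ w * g x
    P-resp : P Respects S._≈_
    P-resp x≈y Px = trans (*-cong (^-congˡ M (g-cong (S.sym x≈y))) (g-cong (S.sym x≈y)))
      (trans Px (*-congˡ (g-cong x≈y)))
    root : ∀ x → ¬ P x → geometric w m (g x ^ M) ≈ 0#
    root x ¬Px = geometric-root {m = m} (begin
        (g x ^ M) ^ suc m       ≈⟨ ^-assocʳ (g x) M (suc m) ⟩
        g x ^ (M ℕ.* suc m)     ≈⟨ *-cancelʳ (g x) gx≉0 (trans (g^ x) (sym (*-identityˡ _))) ⟩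
        1#                      ≈⟨ w^≈1 ⟨
        w ^ suc m               ∎)
      λ y≈w → ¬Px (*-congʳ y≈w)
      where
      gx≉0 : ¬ g x ≈ 0#
      gx≉0 gx≈0 = ¬Px (trans (*-congˡ gx≈0) (trans (zeroʳ _) (sym (trans (*-congˡ gx≈0) (zeroʳ w)))))

  -- Multiplication by x ∈ K permutes K, so the product of the nonzero elements of K is
  -- unchanged by it.
  subfield-fermat : ∀ {K m} → IsSubfield K → HasSize (subsetoid setoid K) m →
                    ∀ {x} → x ∈ K → x ^ m ≈ x
  subfield-fermat {K} {m} subfield sizeK {x} x∈K with x ≟ 0#
  ... | yes x≈0 = trans (^-congˡ m x≈0) (trans (0^ m m>0) (sym x≈0))
    where
    m>0 : 0 ℕ.< m
    m>0 = ℕ.≤-trans (s≤s z≤n) (Fin.toℕ<n (Inverse.to sizeK (x , x∈K)))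
  ... | no x≉0 = begin
      x ^ m                                 ≈⟨ ∏.sum-replicate m ⟨
      ∏.sum (replicate m x)                 ≈⟨ ∏.sum-cong-≋ (λ i → scale-split (e i)) ⟩
      ∏.sum (λ i → scale (e i) * rest (e i)) ≈⟨ ∏.∑-distrib-+ (scale ∘ e) (rest ∘ e) ⟩
      ∏.sum (scale ∘ e) * ∏.sum (rest ∘ e)  ≈⟨ *-cong ∏scale≈1 ∏rest≈x ⟩
      1# * x                                ≈⟨ *-identityˡ x ⟩
      x                                     ∎
    where
    open IsSubfield subfield
    open Inverse sizeK using (to; from; to-cong; strictlyInverseˡ; strictlyInverseʳ)
    e : Fin m → Carrier
    e i = proj₁ (from i)

    y : Carrier
    y = proj₁ (inverse x x≉0)
    xy≈1 : x * y ≈ 1#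
    xy≈1 = proj₂ (inverse x x≉0)

    mul : ∀ {z} → z ∈ K → Fin m → Fin m
    mul z∈K i = to (_ , *-closed z∈K (proj₂ (from i)))
    mul-mul : ∀ {u v} (u∈K : u ∈ K) (v∈K : v ∈ K) → u * v ≈ 1# → ∀ i → mul u∈K (mul v∈K i) ≡ i
    mul-mul {u} {v} u∈K v∈K uv≈1 i = ≡.trans (to-cong (begin
      u * proj₁ (from (mul v∈K i))   ≈⟨ *-congˡ (strictlyInverseʳ _) ⟩
      u * (v * e i)                  ≈⟨ *-assoc u v _ ⟨
      (u * v) * e i                  ≈⟨ *-congʳ uv≈1 ⟩
      1# * e i                       ≈⟨ *-identityˡ _ ⟩
      e i                            ∎)) (strictlyInverseˡ i)
    y∈K = inv-closed x∈K xy≈1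
    π = permutation (mul x∈K) (mul y∈K) (mul-mul x∈K y∈K xy≈1) (mul-mul y∈K x∈K (trans (*-comm y x) xy≈1))

    -- The product over all of K contains the factor 0, which `unit` replaces by 1. Splitting x as
    -- `scale u * rest u` turns x^m into the product of all `scale u`, which is x^(m-1), times the
    -- single `rest` that differs from 1, which is x.
    unit scale rest : Carrier → Carrier
    unit u with u ≟ 0#
    ... | yes _ = 1#
    ... | no  _ = u
    scale u with u ≟ 0#
    ... | yes _ = 1#
    ... | no  _ = x
    rest u with u ≟ 0#
    ... | yes _ = x
    ... | no  _ = 1#

    scale-split : ∀ u → x ≈ scale u * rest u
    scale-split u with u ≟ 0#
    ... | yes _ = sym (*-identityˡ x)
    ... | no  _ = sym (*-identityʳ x)

    unit-≉0 : ∀ u → ¬ unit u ≈ 0#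
    unit-≉0 u with u ≟ 0#
    ... | yes _  = 1≉0
    ... | no u≉0 = u≉0

    unit-* : ∀ u v → v ≈ x * u → unit v ≈ scale u * unit u
    unit-* u v v≈xu with u ≟ 0# | v ≟ 0#
    ... | yes _   | yes _  = sym (*-identityˡ 1#)
    ... | yes u≈0 | no v≉0 = contradiction (trans v≈xu (trans (*-congˡ u≈0) (zeroʳ x))) v≉0
    ... | no u≉0  | yes v≈0 = contradiction (trans (sym v≈xu) v≈0) (*-≉0 x≉0 u≉0)
    ... | no _    | no _   = v≈xu

    ∏-≉0 : ∀ {k} {f : Fin k → Carrier} → (∀ i → ¬ f i ≈ 0#) → ¬ ∏.sum f ≈ 0#
    ∏-≉0 {zero}  f≉0 = 1≉0
    ∏-≉0 {suc k} f≉0 = *-≉0 (f≉0 zero) (∏-≉0 (f≉0 ∘ suc))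

    ∏scale≈1 : ∏.sum (scale ∘ e) ≈ 1#
    ∏scale≈1 = *-cancelʳ (∏.sum (unit ∘ e)) (∏-≉0 (unit-≉0 ∘ e)) (begin
      ∏.sum (scale ∘ e) * ∏.sum (unit ∘ e)     ≈⟨ ∏.∑-distrib-+ (scale ∘ e) (unit ∘ e) ⟨
      ∏.sum (λ i → scale (e i) * unit (e i))   ≈⟨ ∏.sum-cong-≋ (λ i →
                                                     unit-* (e i) (e (mul x∈K i)) (strictlyInverseʳ _)) ⟨
      ∏.sum (unit ∘ e ∘ mul x∈K)               ≈⟨ ∏.sum-permute (unit ∘ e) π ⟨
      ∏.sum (unit ∘ e)                         ≈⟨ *-identityˡ _ ⟨
      1# * ∏.sum (unit ∘ e)                    ∎)

    rest-≉0 : ∀ {u} → ¬ u ≈ 0# → rest u ≈ 1#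
    rest-≉0 {u} u≉0 with u ≟ 0#
    ... | yes u≈0 = contradiction u≈0 u≉0
    ... | no  _   = refl
    rest-≈0 : ∀ {u} → u ≈ 0# → rest u ≈ x
    rest-≈0 {u} u≈0 with u ≟ 0#
    ... | yes _   = refl
    ... | no  u≉0 = contradiction u≈0 u≉0

    i₀ = to (0# , 0-closed)
    ∏rest≈x : ∏.sum (rest ∘ e) ≈ x
    ∏rest≈x = trans
      (sum-single *-commutativeMonoid i₀ λ i i≢i₀ → rest-≉0 λ ei≈0 → i≢i₀
        (from-injective (subsetoid setoid K) sizeK (trans ei≈0 (sym (strictlyInverseʳ _)))))
      (rest-≈0 (strictlyInverseʳ _))

  everything : IsSubfield (λ _ → ⊤)
  everything = _

  fermat : ∀ x → x ^ N ≈ x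
  fermat x = subfield-fermat everything record
    { to        = to ∘ proj₁
    ; from      = λ i → from i , tt
    ; to-cong   = to-cong
    ; from-cong = from-cong
    ; inverse   = (λ eq → inverseˡ eq) , λ eq → inverseʳ eq
    }
    tt
    where
    open Inverse size using (to; from; to-cong; from-cong; inverseˡ; inverseʳ)

  -- Adding 1 permutes the field, so the sum of all elements is unchanged by adding N · 1.
  N×1≈0 : N ×# 1# ≈ 0#
  N×1≈0 = ∙-cancelʳ (sum from) _ _ (begin
    N ×# 1# + sum from                      ≈⟨ +-congʳ (sum-replicate N) ⟨
    sum (replicate N 1#) + sum from         ≈⟨ ∑-distrib-+ (replicate N 1#) from ⟨
    sum (λ i → 1# + from i)                 ≈⟨ sum-cong-≋ (λ i → strictlyInverseʳ (1# + from i)) ⟨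
    sum (λ i → from (add 1# i))             ≈⟨ sum-permute from π ⟨
    sum from                                ≈⟨ +-identityˡ _ ⟨
    0# + sum from                           ∎)
    where
    open Inverse size using (to; from; to-cong; strictlyInverseˡ; strictlyInverseʳ)
    add : Carrier → Fin N → Fin N
    add u i = to (u + from i)
    add-add : ∀ {u v} → u + v ≈ 0# → ∀ i → add u (add v i) ≡ i
    add-add {u} {v} u+v≈0 i = ≡.trans (to-cong (begin
      u + from (add v i)   ≈⟨ +-congˡ (strictlyInverseʳ _) ⟩
      u + (v + from i)     ≈⟨ +-assoc u v _ ⟨
      (u + v) + from i     ≈⟨ +-congʳ u+v≈0 ⟩
      0# + from i          ≈⟨ +-identityˡ _ ⟩
      from i               ∎)) (strictlyInverseˡ i)
    π = permutation (add 1#) (add (- 1#)) (add-add (-‿inverseʳ 1#)) (add-add (-‿inverseˡ 1#))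

  characteristic : ∀ p k → (p ℕ.^ k) ×# 1# ≈ 0# → p ×# 1# ≈ 0#
  characteristic p zero    1×1≈0 = contradiction (trans (sym (+-identityʳ 1#)) 1×1≈0) 1≉0
  characteristic p (suc k) eq with *-zero-product (trans (sym (×1-homo-* p (p ℕ.^ k))) eq)
  ... | inj₁ p≈0 = p≈0
  ... | inj₂ pᵏ≈0 = characteristic p k pᵏ≈0

  module Frobenius {p} (p-prime : Prime p) (p×1≈0 : p ×# 1# ≈ 0#) where

    ∣⇒×≈0 : ∀ {m} → p ∣ m → ∀ x → m ×# x ≈ 0#
    ∣⇒×≈0 (divides k ≡.refl) x = begin
      (k ℕ.* p) ×# x            ≈⟨ ×#-* (k ℕ.* p) x ⟩
      ((k ℕ.* p) ×# 1#) * x     ≈⟨ *-congʳ (×1-homo-* k p) ⟩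
      (k ×# 1# * p ×# 1#) * x   ≈⟨ *-congʳ (*-congˡ p×1≈0) ⟩
      (k ×# 1# * 0#) * x        ≈⟨ *-congʳ (zeroʳ _) ⟩
      0# * x                    ≈⟨ zeroˡ x ⟩
      0#                        ∎

    ^p-+ : ∀ x y → (x + y) ^ p ≈ x ^ p + y ^ p
    ^p-+ x y = go p ≡.refl
      where
      open Binomial commutativeSemiring using (theorem; binomial; binomialTerm)
      -- The exponent becomes a variable so that it can be matched as a successor. The binomial sum
      -- then splits into its first term and a tail, of which only the last term survives modulo p.
      go : ∀ m → m ≡ p → (x + y) ^ m ≈ x ^ m + y ^ m
      go zero 0≡p = contradiction (≡.sym 0≡p) (ℕ.≢-nonZero⁻¹ p {{prime⇒nonZero p-prime}})
      go (suc m) 1+m≡p = begin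
        (x + y) ^ suc m                                   ≈⟨ theorem (suc m) x y ⟩
        term zero + sum (term ∘ suc)                      ≈⟨ +-congˡ (sum-single +-commutativeMonoid (fromℕ m) λ j j≢m →
          ∣⇒×≈0 (≡.subst (λ n → n ∣ (suc m C suc (toℕ j))) 1+m≡p (middle j j≢m))
                (binomial x y (suc m) (suc j))) ⟩
        term zero + term (suc (fromℕ m))                  ≈⟨ +-cong first last ⟩
        y ^ suc m + x ^ suc m                             ≈⟨ +-comm _ _ ⟩
        x ^ suc m + y ^ suc m                             ∎
        where
        term = binomialTerm x y (suc m)
        1×# : ∀ u → 1 ×# u ≈ u
        1×# u = +-identityʳ u
        first : term zero ≈ y ^ suc m
        first = trans (1×# _) (*-identityˡ _)
        last : term (suc (fromℕ m)) ≈ x ^ suc m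
        last rewrite Fin.toℕ-fromℕ m | nCn≡1 (suc m) | ℕ.n∸n≡0 m = trans (1×# _) (*-identityʳ _)
        middle : ∀ j → j ≢ fromℕ m → suc m ∣ (suc m C suc (toℕ j))
        middle j j≢m = prime∣C (≡.subst Prime (≡.sym 1+m≡p) p-prime) (suc (toℕ j)) (s≤s z≤n)
          (s≤s (ℕ.≤∧≢⇒< (Fin.toℕ≤pred[n] j) λ eq → j≢m (Fin.toℕ-injective (≡.trans eq (≡.sym (Fin.toℕ-fromℕ m))))))

    ^pᵏ-+ : ∀ k x y → (x + y) ^ (p ℕ.^ k) ≈ x ^ (p ℕ.^ k) + y ^ (p ℕ.^ k)
    ^pᵏ-+ zero    x y = trans (*-identityʳ _) (+-cong (sym (*-identityʳ x)) (sym (*-identityʳ y)))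
    ^pᵏ-+ (suc k) x y = begin
      (x + y) ^ (p ℕ.* p ℕ.^ k)                    ≈⟨ ^-assocʳ (x + y) p (p ℕ.^ k) ⟨
      ((x + y) ^ p) ^ (p ℕ.^ k)                    ≈⟨ ^-congˡ (p ℕ.^ k) (^p-+ x y) ⟩
      (x ^ p + y ^ p) ^ (p ℕ.^ k)                  ≈⟨ ^pᵏ-+ k (x ^ p) (y ^ p) ⟩
      (x ^ p) ^ (p ℕ.^ k) + (y ^ p) ^ (p ℕ.^ k)    ≈⟨ +-cong (^-assocʳ x p (p ℕ.^ k)) (^-assocʳ y p (p ℕ.^ k)) ⟩
      x ^ (p ℕ.* p ℕ.^ k) + y ^ (p ℕ.* p ℕ.^ k)    ∎

-- Fixed fields of Frobenius powers.

1<prime-power : ∀ {q} → IsPrimePower q → 1 ℕ.< q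
1<prime-power (p , suc e , p-prime , _ , ≡.refl) =
  ℕ.<-≤-trans (ℕ.nonTrivial⇒n>1 p {{prime⇒nonTrivial p-prime}})
    (ℕ.m≤m*n p (p ℕ.^ e) {{ℕ.m^n≢0 p e {{ℕ.nonTrivial⇒nonZero p {{prime⇒nonTrivial p-prime}}}}}})

-- x - 1 divides x^(k+1) - 1, in the form q^n = 1 + M (m + 1) with M = q^t - 1 that fits the
-- exponent in `power-count`.
^-suc-factor : ∀ M k → ∃ λ m → suc M ℕ.^ suc k ≡ suc (M ℕ.* suc m)
^-suc-factor M zero    = 0 , ≡.trans (ℕ.*-identityʳ (suc M)) (≡.cong suc (≡.sym (ℕ.*-identityʳ M)))
^-suc-factor M (suc k) =
  let m , eq = ^-suc-factor M k in
  suc M ℕ.* suc m , ≡.trans (≡.cong (suc M ℕ.*_) eq)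
    (solve 2 (λ M m → (con 1 :+ M) :* (con 1 :+ M :* (con 1 :+ m)) :=
       con 1 :+ M :* (con 1 :+ (con 1 :+ M) :* (con 1 :+ m))) ≡.refl M m)
  where open +-*-Solver

module FixedFields {c ℓ} (q n : ℕ) (q-prime-power : IsPrimePower q) .{{_ : NonTrivial n}}
                   (F : FiniteField c ℓ (q ℕ.^ n)) where
  open FiniteField F hiding (zero)
  open FieldProperties F
  open QPolynomials q n F using (LinearlyDependent)
  open RingProperties ring using (-‿distribˡ-*; -1*x≈-x)
  open GroupProperties +-abelianGroup using (x∙y⁻¹≈ε⇒x≈y; x≈y⇒x∙y⁻¹≈ε; inverseʳ-unique)
  open Exp commutativeSemiring using (^-congˡ; ^-congʳ; ^-assocʳ; ^-distrib-*)
  open Mult semiring using () renaming (_×_ to _×#_)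
  open import Relation.Binary.Reasoning.Setoid setoid
  private
    module R = Solver commutativeSemiring
    open R using (_:+_; _:*_; _:=_)
    p = proj₁ q-prime-power
    e = proj₁ (proj₂ q-prime-power)
    p-prime : Prime p
    p-prime = proj₁ (proj₂ (proj₂ q-prime-power))
    q≡pᵉ : q ≡ p ℕ.^ e
    q≡pᵉ = proj₂ (proj₂ (proj₂ (proj₂ q-prime-power)))

    qᵏ≡pᵉᵏ : ∀ k → q ℕ.^ k ≡ p ℕ.^ (e ℕ.* k)
    qᵏ≡pᵉᵏ k = ≡.trans (≡.cong (ℕ._^ k) q≡pᵉ) (ℕ.^-*-assoc p e k)

  open Frobenius p-prime (characteristic p (e ℕ.* n)
    (≡.subst (λ m → m ×# 1# ≈ 0#) (qᵏ≡pᵉᵏ n) N×1≈0)) public using (^pᵏ-+)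

  1<q : 1 ℕ.< q
  1<q = 1<prime-power q-prime-power

  instance
    q≢0 : NonZero q
    q≢0 = ℕ.>-nonZero (ℕ.<-trans (s≤s z≤n) 1<q)
    n≢0 : NonZero n
    n≢0 = ℕ.nonTrivial⇒nonZero n

  0<q^ : ∀ k → 0 ℕ.< q ℕ.^ k
  0<q^ k = ℕ.m^n>0 q k

  1<q^ : ∀ {k} → 0 ℕ.< k → 1 ℕ.< q ℕ.^ k
  1<q^ {k} 0<k = ℕ.^-monoʳ-< q 1<q 0<k

  q^-cancel-≤ : ∀ {j k} → q ℕ.^ j ℕ.≤ q ℕ.^ k → j ℕ.≤ k
  q^-cancel-≤ {j} {k} qʲ≤qᵏ with j ℕ.≤? k
  ... | yes j≤k = j≤k
  ... | no j≰k  = contradiction qʲ≤qᵏ (ℕ.<⇒≱ (ℕ.^-monoʳ-< q 1<q (ℕ.≰⇒> j≰k)))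

  φ : ℕ → Carrier → Carrier
  φ k x = x ^ (q ℕ.^ k)

  φ-cong : ∀ k {x y} → x ≈ y → φ k x ≈ φ k y
  φ-cong k = ^-congˡ (q ℕ.^ k)

  φ-+ : ∀ k x y → φ k (x + y) ≈ φ k x + φ k y
  φ-+ k x y rewrite qᵏ≡pᵉᵏ k = ^pᵏ-+ (e ℕ.* k) x y

  φ-* : ∀ k x y → φ k (x * y) ≈ φ k x * φ k y
  φ-* k x y = ^-distrib-* x y (q ℕ.^ k)

  φ-0 : ∀ k → φ k 0# ≈ 0#
  φ-0 k = 0^ (q ℕ.^ k) (0<q^ k)

  φ-1 : ∀ k → φ k 1# ≈ 1#
  φ-1 k = 1^ (q ℕ.^ k)

  φ-≉0 : ∀ k {x} → ¬ x ≈ 0# → ¬ φ k x ≈ 0#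
  φ-≉0 k = ^-≉0 (q ℕ.^ k)

  φ-‿ : ∀ k x → φ k (- x) ≈ - φ k x
  φ-‿ k x = inverseʳ-unique (φ k x) (φ k (- x)) (begin
    φ k x + φ k (- x)   ≈⟨ φ-+ k x (- x) ⟨
    φ k (x - x)         ≈⟨ φ-cong k (-‿inverseʳ x) ⟩
    φ k 0#              ≈⟨ φ-0 k ⟩
    0#                  ∎)

  φ-∘ : ∀ j k x → φ j (φ k x) ≈ φ (k ℕ.+ j) x
  φ-∘ j k x = trans (^-assocʳ x (q ℕ.^ k) (q ℕ.^ j)) (^-congʳ x (≡.sym (ℕ.^-distribˡ-+-* q k j)))

  φ-comm : ∀ j k x → φ j (φ k x) ≈ φ k (φ j x)
  φ-comm j k x = trans (φ-∘ j k x) (trans (^-congʳ x (≡.cong (q ℕ.^_) (ℕ.+-comm k j))) (sym (φ-∘ k j x)))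

  φ-≡ : ∀ {j k} x → j ≡ k → φ j x ≈ φ k x
  φ-≡ x ≡.refl = refl

  φ-n : ∀ x → φ n x ≈ x
  φ-n = fermat

  φ-injective : ∀ k {x y} → φ k x ≈ φ k y → x ≈ y
  φ-injective k {x} {y} eq with (x - y) ≟ 0#
  ... | yes x-y≈0 = x∙y⁻¹≈ε⇒x≈y x y x-y≈0
  ... | no x-y≉0 = contradiction (begin
    φ k (x - y)           ≈⟨ φ-+ k x (- y) ⟩
    φ k x + φ k (- y)     ≈⟨ +-cong eq (φ-‿ k y) ⟩
    φ k y - φ k y         ≈⟨ -‿inverseʳ _ ⟩
    0#                    ∎) (φ-≉0 k x-y≉0)

  -- For k dividing n this is the subfield of order q^k. Unlike `𝔽`, which quantifies over all
  -- subfields, it is a decidable equation; `𝔽⇒Fixed` and `Fixed⇒𝔽` translate between the two.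
  Fixed : ℕ → Pred Carrier ℓ
  Fixed k x = φ k x ≈ x

  Fixed-resp : ∀ k → Fixed k Respects _≈_
  Fixed-resp k x≈y fx = trans (φ-cong k (sym x≈y)) (trans fx x≈y)

  Fixed-subfield : ∀ k → IsSubfield (Fixed k)
  Fixed-subfield k = record
    { resp       = Fixed-resp k
    ; 0-closed   = φ-0 k
    ; 1-closed   = φ-1 k
    ; +-closed   = λ fx fy → trans (φ-+ k _ _) (+-cong fx fy)
    ; neg-closed = λ fx → trans (φ-‿ k _) (-‿cong fx)
    ; *-closed   = λ fx fy → trans (φ-* k _ _) (*-cong fx fy)
    ; inv-closed = λ {x} {y} fx xy≈1 → *-cancelˡ x (λ x≈0 → 1≉0
        (trans (sym xy≈1) (trans (*-congʳ x≈0) (zeroˡ y)))) (begin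
        x * φ k y        ≈⟨ *-congʳ fx ⟨
        φ k x * φ k y    ≈⟨ φ-* k x y ⟨
        φ k (x * y)      ≈⟨ φ-cong k xy≈1 ⟩
        φ k 1#           ≈⟨ φ-1 k ⟩
        1#               ≈⟨ xy≈1 ⟨
        x * y            ∎)
    }

  module Fixed k = IsSubfield (Fixed-subfield k)

  Fixed-φ : ∀ k j {x} → Fixed k x → Fixed k (φ j x)
  Fixed-φ k j fx = trans (φ-comm k j _) (φ-cong j fx)

  Fixed-multiple : ∀ {k} m {x} → Fixed k x → Fixed (m ℕ.* k) x
  Fixed-multiple zero        fx = *-identityʳ _
  Fixed-multiple {k} (suc m) {x} fx =
    trans (sym (φ-∘ (m ℕ.* k) k x)) (trans (φ-cong (m ℕ.* k) fx) (Fixed-multiple m fx))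

  φ-+multiple : ∀ {k x} → Fixed k x → ∀ j m → φ (j ℕ.+ m ℕ.* k) x ≈ φ j x
  φ-+multiple {k} {x} fx j m = begin
    φ (j ℕ.+ m ℕ.* k) x     ≈⟨ φ-≡ x (ℕ.+-comm j _) ⟩
    φ (m ℕ.* k ℕ.+ j) x     ≈⟨ φ-∘ j (m ℕ.* k) x ⟨
    φ j (φ (m ℕ.* k) x)     ≈⟨ φ-cong j (Fixed-multiple m fx) ⟩
    φ j x                   ∎

  φ-% : ∀ {k x} .{{_ : NonZero k}} → Fixed k x → ∀ j → φ j x ≈ φ (j % k) x
  φ-% {k} {x} fx j = trans (φ-≡ x (m≡m%n+[m/n]*n j k)) (φ-+multiple fx (j % k) (j / k))

  -- Bézout writes gcd + b k = a j, or the same with j and k exchanged. Adding a multiple of a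
  -- period to the exponent does not change the value of φ at x, and a multiple of a period fixes x.
  Fixed-gcd : ∀ j k {x} → Fixed j x → Fixed k x → Fixed (gcd j k) x
  Fixed-gcd j k {x} fj fk with Bézout.identity {d = gcd j k} (gcd-GCD j k)
  ... | Bézout.+- a b eq = trans (sym (φ-+multiple fk (gcd j k) b))
          (trans (φ-≡ x eq) (Fixed-multiple a fj))
  ... | Bézout.-+ a b eq = trans (sym (φ-+multiple fj (gcd j k) a))
          (trans (φ-≡ x eq) (Fixed-multiple b fk))

  Fixed-size-≤ : ∀ {a ℓ′} {S : Setoid a ℓ′} (let module S = Setoid S) (g : S.Carrier → Carrier) →
    (∀ {x y} → g x ≈ g y → x S.≈ y) → ∀ {k} → HasSize S k →
    ∀ j → 0 ℕ.< j → (∀ x → Fixed j (g x)) → k ℕ.≤ q ℕ.^ j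
  Fixed-size-≤ g g-injective size j 0<j fixed = root-bound-size g g-injective 1≉0
    (Poly-add-lower (Poly-^ (q ℕ.^ j)) (Poly-scale (- 1#) (Poly-^ 1)) (1<q^ 0<j)) size λ x →
    trans (+-cong (fixed x) (trans (*-congˡ (*-identityʳ _)) (-1*x≈-x _))) (-‿inverseʳ _)

  -- With M = q^t - 1 and q^n - 1 = M (m + 1), `power-count` for w = 1 gives q^n ≤ l + m M, where l
  -- is the number of fixed elements. Since q^n = q^t + m M, this says q^t ≤ l; the reverse
  -- inequality bounds the roots of x^(q^t) - x.
  Fixed-size : ∀ {t} → t ∣ n → 0 ℕ.< t → HasSize (subsetoid setoid (Fixed t)) (q ℕ.^ t)
  Fixed-size {t} (divides zero n≡0) 0<t = contradiction n≡0 (ℕ.≢-nonZero⁻¹ n)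
  Fixed-size {t} (divides (suc k) n≡1+k*t) 0<t =
    let l , sizeP , N≤l+mM = power-count {S = setoid} id id id size {M} {m} {1#} M>0 (1^ (suc m)) x^≈x
        sizeP′ = convert sizeP
        l≤qᵗ = Fixed-size-≤ proj₁ id sizeP′ t 0<t proj₂
        qᵗ≤l = ≡.subst (ℕ._≤ l) 1+M≡qᵗ (ℕ.+-cancelʳ-≤ (m ℕ.* M) (suc M) l
                 (≡.subst (ℕ._≤ l ℕ.+ m ℕ.* M) N≡ N≤l+mM))
    in ≡.subst (HasSize (subsetoid setoid (Fixed t))) (ℕ.≤-antisym l≤qᵗ qᵗ≤l) sizeP′
    where
    M = ℕ.pred (q ℕ.^ t)
    1+M≡qᵗ : suc M ≡ q ℕ.^ t
    1+M≡qᵗ = ℕ.suc-pred (q ℕ.^ t) {{ℕ.m^n≢0 q t}}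
    M>0 : 0 ℕ.< M
    M>0 = ℕ.s<s⁻¹ (≡.subst (1 ℕ.<_) (≡.sym 1+M≡qᵗ) (1<q^ 0<t))
    m = proj₁ (^-suc-factor M k)
    N≡1+M[1+m] : q ℕ.^ n ≡ suc (M ℕ.* suc m)
    N≡1+M[1+m] = ≡.trans (≡.cong (q ℕ.^_) (≡.trans n≡1+k*t (ℕ.*-comm (suc k) t)))
      (≡.trans (≡.sym (ℕ.^-*-assoc q t (suc k)))
      (≡.trans (≡.cong (ℕ._^ suc k) (≡.sym 1+M≡qᵗ)) (proj₂ (^-suc-factor M k))))
    N≡ : q ℕ.^ n ≡ suc M ℕ.+ m ℕ.* M
    N≡ = ≡.trans N≡1+M[1+m] (≡.cong suc (ℕ.*-comm M (suc m)))
    x^≈x : ∀ x → x ^ (M ℕ.* suc m) * x ≈ x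
    x^≈x x = trans (*-comm _ x) (trans (^-congʳ x (≡.sym N≡1+M[1+m])) (fermat x))
    fixed⇒ : ∀ {x} → Fixed t x → x ^ M * x ≈ 1# * x
    fixed⇒ {x} fx = trans (*-comm _ x) (trans (^-congʳ x 1+M≡qᵗ) (trans fx (sym (*-identityˡ x))))
    ⇒fixed : ∀ {x} → x ^ M * x ≈ 1# * x → Fixed t x
    ⇒fixed {x} eq = trans (^-congʳ x (≡.sym 1+M≡qᵗ)) (trans (*-comm x _) (trans eq (*-identityˡ x)))
    convert : ∀ {l} → HasSize (subsetoid setoid λ x → x ^ M * x ≈ 1# * x) l →
              HasSize (subsetoid setoid (Fixed t)) l
    convert sizeP = record
      { to        = λ (x , fx) → Inverse.to sizeP (x , fixed⇒ fx)
      ; from      = λ i → let x , Px = Inverse.from sizeP i in x , ⇒fixed Px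
      ; to-cong   = λ eq → Inverse.to-cong sizeP eq
      ; from-cong = λ eq → Inverse.from-cong sizeP eq
      ; inverse   = (λ eq → Inverse.inverseˡ sizeP eq) , λ eq → Inverse.inverseʳ sizeP eq
      }

  -- Comparison of orders alone. This is how an inclusion of fixed fields is turned into an
  -- inequality of exponents, usually one that contradicts s < t.
  Fixed-nested : ∀ {j k} → j ∣ n → 0 ℕ.< j → 0 ℕ.< k → (∀ {x} → Fixed j x → Fixed k x) → j ℕ.≤ k
  Fixed-nested {j} {k} j∣n 0<j 0<k nested = q^-cancel-≤
    (Fixed-size-≤ proj₁ id (Fixed-size j∣n 0<j) k 0<k λ (x , fx) → nested fx)

  -- Fermat's identity holds in whichever subfield of order q^k witnesses the membership.
  𝔽⇒Fixed : ∀ {k x} → x ∈ 𝔽 (q ℕ.^ k) → Fixed k x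
  𝔽⇒Fixed (K , subfield , sizeK , x∈K) = subfield-fermat subfield sizeK x∈K

  Fixed⇒𝔽 : ∀ {k x} → k ∣ n → 0 ℕ.< k → Fixed k x → x ∈ 𝔽 (q ℕ.^ k)
  Fixed⇒𝔽 {k} k∣n 0<k fx = Fixed k , Fixed-subfield k , Fixed-size k∣n 0<k , fx

  𝔽q⇒Fixed : ∀ {x} → x ∈ 𝔽 q → Fixed 1 x
  𝔽q⇒Fixed {x} x∈ = 𝔽⇒Fixed {1} (≡.subst (λ m → x ∈ 𝔽 m) (≡.sym (ℕ.*-identityʳ q)) x∈)

  -- Lines over F_q and a dimension bound by counting.

  Multiple : Carrier → Carrier → Set (c ⊔ ℓ)
  Multiple y z = ∃ λ μ → Fixed 1 μ × z ≈ μ * y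

  dependent⇒multiple : ∀ {y z} → LinearlyDependent y z → ¬ y ≈ 0# → Multiple y z
  dependent⇒multiple {y} {z} (α , β , α∈ , β∈ , not-both , αy+βz≈0) y≉0 =
    - (γ * α) , Fixed.neg-closed 1 (Fixed.*-closed 1 (Fixed.inv-closed 1 (𝔽q⇒Fixed β∈) βγ≈1) (𝔽q⇒Fixed α∈)) ,
    trans (inverseʳ-unique (γ * α * y) z (begin
      γ * α * y + z                ≈⟨ +-congˡ (trans (sym (*-identityˡ z)) (*-congʳ (sym βγ≈1))) ⟩
      γ * α * y + β * γ * z        ≈⟨ R.solve 5 (λ α β γ y z → γ :* α :* y :+ β :* γ :* z :=
                                         γ :* (α :* y :+ β :* z)) refl α β γ y z ⟩
      γ * (α * y + β * z)          ≈⟨ *-congˡ αy+βz≈0 ⟩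
      γ * 0#                       ≈⟨ zeroʳ γ ⟩
      0#                           ∎)) (-‿distribˡ-* (γ * α) y)
    where
    β≉0 : ¬ β ≈ 0#
    β≉0 β≈0 with *-zero-product (begin
      α * y            ≈⟨ +-identityʳ _ ⟨
      α * y + 0#       ≈⟨ +-congˡ (trans (*-congʳ β≈0) (zeroˡ z)) ⟨
      α * y + β * z    ≈⟨ αy+βz≈0 ⟩
      0#               ∎)
    ... | inj₁ α≈0 = not-both (α≈0 , β≈0)
    ... | inj₂ y≈0 = y≉0 y≈0
    γ = proj₁ (inverse β β≉0)
    βγ≈1 : β * γ ≈ 1#
    βγ≈1 = proj₂ (inverse β β≉0)

  any? : ∀ {p} {P : Pred Carrier p} → P Respects _≈_ → Decidable P → Dec (∃ P)
  any? resp P? = map′ (λ (i , Pi) → Inverse.from size i , Pi)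
    (λ (x , Px) → Inverse.to size x , resp (sym (Inverse.strictlyInverseʳ size x)) Px)
    (Fin.any? (P? ∘ Inverse.from size))

  -- Any nonzero value of f on P spans all the others, as they are pairwise dependent. If every
  -- value is 0, then any w serves, with coefficient 0.
  common-multiple : ∀ {p} {P : Pred Carrier p} → P Respects _≈_ → Decidable P →
    (f : Carrier → Carrier) → (∀ {x y} → x ≈ y → f x ≈ f y) →
    (∀ {x y} → P x → P y → LinearlyDependent (f x) (f y)) →
    ∃ λ w → ∀ x → P x → Multiple (f w) (f x)
  common-multiple {P = P} resp P? f f-cong dependent
    with any? {P = λ x → P x × ¬ f x ≈ 0#}
           (λ x≈y (Px , fx≉0) → resp x≈y Px , λ fy≈0 → fx≉0 (trans (f-cong x≈y) fy≈0))
           (λ x → P? x ×-dec ¬? (f x ≟ 0#))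
  ... | yes (w , Pw , fw≉0) = w , λ x Px → dependent⇒multiple (dependent Pw Px) fw≉0
  ... | no none = 0# , λ x Px → 0# , φ-0 1 , trans (fx≈0 x Px) (sym (zeroˡ _))
    where
    fx≈0 : ∀ x → P x → f x ≈ 0#
    fx≈0 x Px with f x ≟ 0#
    ... | yes fx≈0 = fx≈0
    ... | no fx≉0  = contradiction (x , Px , fx≉0) none

  -- The pairs of coefficients in F_q number q^2 and map onto a field with q^n elements.
  spanning⇒≤2 : ∀ w v → (∀ x → ∃₂ λ μ ν → Fixed 1 μ × Fixed 1 ν × x ≈ μ * w + ν * v) → n ℕ.≤ 2
  spanning⇒≤2 w v span = q^-cancel-≤ (≡.subst (q ℕ.^ n ℕ.≤_) q*q≡q²
    (size-≤-surjective (Fin.≡-setoid _) setoid (Identity.inverse _) size combination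
      (λ { ≡.refl → refl }) onto))
    where
    sizeK = Fixed-size {1} (divides n (≡.sym (ℕ.*-identityʳ n))) (s≤s z≤n)
    open Inverse sizeK
    Q = q ℕ.^ 1
    q*q≡q² : Q ℕ.* Q ≡ q ℕ.^ 2
    q*q≡q² = ≡.sym (ℕ.^-distribˡ-+-* q 1 1)
    combination : Fin (Q ℕ.* Q) → Carrier
    combination i = let a , b = remQuot {Q} Q i in proj₁ (from a) * w + proj₁ (from b) * v
    onto : ∀ x → ∃ λ i → combination i ≈ x
    onto x = let μ , ν , fμ , fν , x≈ = span x in combine (to (μ , fμ)) (to (ν , fν)) ,
      (begin
        combination (combine (to (μ , fμ)) (to (ν , fν)))                      ≡⟨
          ≡.cong (λ (a , b) → proj₁ (from a) * w + proj₁ (from b) * v)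
            (Fin.remQuot-combine (to (μ , fμ)) (to (ν , fν))) ⟩
        proj₁ (from (to (μ , fμ))) * w + proj₁ (from (to (ν , fν))) * v        ≈⟨
          +-cong (*-congʳ (strictlyInverseʳ (μ , fμ))) (*-congʳ (strictlyInverseʳ (ν , fν))) ⟩
        μ * w + ν * v                                                          ≈⟨ x≈ ⟨
        x                                                                      ∎)

  -- Let L w span the image and v the kernel. If L x = μ L w, then x - μ w lies in the kernel and
  -- equals some ν v, so w and v span the whole field.
  rank-nullity-≤2 : (L : Carrier → Carrier) → (∀ {x y} → x ≈ y → L x ≈ L y) →
    (∀ x y → L (x + y) ≈ L x + L y) → (∀ {μ} → Fixed 1 μ → ∀ x → L (μ * x) ≈ μ * L x) →
    (∀ x y → LinearlyDependent (L x) (L y)) →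
    (∀ {x y} → L x ≈ 0# → L y ≈ 0# → LinearlyDependent x y) → n ℕ.≤ 2
  rank-nullity-≤2 L L-cong L-+ L-* image-dependent kernel-dependent =
    let w , image = common-multiple {P = λ x → x ≈ x} (λ _ _ → refl) (λ x → x ≟ x) L L-cong
                      (λ {x} {y} _ _ → image-dependent x y)
        v , kernel = common-multiple {P = λ x → L x ≈ 0#} (λ x≈y Lx≈0 → trans (L-cong (sym x≈y)) Lx≈0)
                       (λ x → L x ≟ 0#) id id kernel-dependent
    in spanning⇒≤2 w v λ x →
      let μ , fμ , Lx≈μLw = image x refl
          ν , fν , x-μw≈νv = kernel (x - μ * w) (begin
            L (x - μ * w)            ≈⟨ L-+ x (- (μ * w)) ⟩
            L x + L (- (μ * w))      ≈⟨ +-congˡ (L-cong (-‿distribˡ-* μ w)) ⟩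
            L x + L (- μ * w)        ≈⟨ +-congˡ (L-* (Fixed.neg-closed 1 fμ) w) ⟩
            L x + - μ * L w          ≈⟨ +-congˡ (-‿distribˡ-* μ (L w)) ⟨
            L x - μ * L w            ≈⟨ x≈y⇒x∙y⁻¹≈ε Lx≈μLw ⟩
            0#                       ∎)
      in μ , ν , fμ , fν , (begin
        x                            ≈⟨ +-identityʳ x ⟨
        x + 0#                       ≈⟨ +-congˡ (-‿inverseˡ (μ * w)) ⟨
        x + (- (μ * w) + μ * w)      ≈⟨ +-assoc _ _ _ ⟨
        (x - μ * w) + μ * w          ≈⟨ +-congʳ x-μw≈νv ⟩
        ν * v + μ * w                ≈⟨ +-comm _ _ ⟩
        μ * w + ν * v                ∎)

-- Exponents modulo t, and q-polynomials as functions.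

∣foldr-gcd : ∀ {d} xs → d ∈ₗ xs → foldr gcd 0 xs ∣ d
∣foldr-gcd (x ∷ xs) (here ≡.refl) = gcd[m,n]∣m x _
∣foldr-gcd (x ∷ xs) (there d∈xs)  = ∣-trans (gcd[m,n]∣n x _) (∣foldr-gcd xs d∈xs)

-- The congruence as an equation between natural numbers (a is 0 or 1), which can be read both
-- modulo t and as an identity between exponents of Frobenius.
⊖-%ℕ : ∀ n .{{_ : NonZero n}} {i j} → i ℕ.< n → j ℕ.< n →
       ∃ λ a → (i ⊖ j) %ℕ n ℕ.+ j ≡ i ℕ.+ a ℕ.* n
⊖-%ℕ n {i} {j} i<n j<n with j ℕ.≤? i
... | yes j≤i rewrite ℤ.⊖-≥ j≤i | m<n⇒m%n≡m (ℕ.≤-<-trans (ℕ.m∸n≤m i j) i<n) =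
  0 , ≡.trans (ℕ.m∸n+n≡m j≤i) (≡.sym (ℕ.+-identityʳ i))
... | no j≰i with j ℕ.∸ i in eq
...   | zero = contradiction (ℕ.m∸n≡0⇒m≤n eq) j≰i
...   | suc d rewrite ℤ.⊖-< (ℕ.≰⇒> j≰i) | eq
                    | m<n⇒m%n≡m (≡.subst (ℕ._< n) eq (ℕ.≤-<-trans (ℕ.m∸n≤m j i) j<n)) =
  1 , (begin
    (n ℕ.∸ suc d) ℕ.+ j              ≡⟨ ≡.cong ((n ℕ.∸ suc d) ℕ.+_)
      (≡.trans (≡.sym (ℕ.m∸n+n≡m (ℕ.≰⇒≥ j≰i))) (≡.cong (ℕ._+ i) eq)) ⟩
    (n ℕ.∸ suc d) ℕ.+ (suc d ℕ.+ i)  ≡⟨ ℕ.+-assoc (n ℕ.∸ suc d) (suc d) i ⟨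
    (n ℕ.∸ suc d) ℕ.+ suc d ℕ.+ i    ≡⟨ ≡.cong (ℕ._+ i)
      (ℕ.m∸n+n≡m (≡.subst (ℕ._≤ n) eq (ℕ.≤-trans (ℕ.m∸n≤m j i) (ℕ.<⇒≤ j<n)))) ⟩
    n ℕ.+ i                          ≡⟨ ℕ.+-comm n i ⟩
    i ℕ.+ n                          ≡⟨ ≡.cong (i ℕ.+_) (ℕ.*-identityˡ n) ⟨
    i ℕ.+ 1 ℕ.* n                    ∎)
  where open ≡.≡-Reasoning

%-shift : ∀ {t d n i j} .{{_ : NonZero t}} a → t ∣ d → t ∣ n → d ℕ.+ j ≡ i ℕ.+ a ℕ.* n → i % t ≡ j % t
%-shift {t} {d} {n} {i} {j} a (divides k ≡.refl) (divides m ≡.refl) d+j≡i+an = begin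
  i % t                            ≡⟨ [m+kn]%n≡m%n i (a ℕ.* m) t ⟨
  (i ℕ.+ a ℕ.* m ℕ.* t) % t        ≡⟨ ≡.cong (λ z → (i ℕ.+ z) % t) (ℕ.*-assoc a m t) ⟩
  (i ℕ.+ a ℕ.* (m ℕ.* t)) % t      ≡⟨ ≡.cong (_% t) d+j≡i+an ⟨
  (k ℕ.* t ℕ.+ j) % t              ≡⟨ ≡.cong (_% t) (ℕ.+-comm (k ℕ.* t) j) ⟩
  (j ℕ.+ k ℕ.* t) % t              ≡⟨ [m+kn]%n≡m%n j k t ⟩
  j % t                            ∎
  where open ≡.≡-Reasoning

module QPolynomialProperties {c ℓ} (q n : ℕ) (q-prime-power : IsPrimePower q) .{{_ : NonTrivial n}}
                             (F : FiniteField c ℓ (q ℕ.^ n)) where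
  open FiniteField F hiding (zero)
  open FieldProperties F
  open FixedFields q n q-prime-power F
  open QPolynomials q n F
  open RingProperties ring using (-‿distribˡ-*)
  open GroupProperties +-abelianGroup using (x∙y⁻¹≈ε⇒x≈y; x≈y⇒x∙y⁻¹≈ε)
  open CommutativeMonoidSum +-commutativeMonoid using (sum-cong-≋; ∑-distrib-+; sum-init-last)
  open SemiringSum semiring using (*-distribˡ-sum)
  open import Relation.Binary.Reasoning.Setoid setoid
  private
    module R = Solver commutativeSemiring
    open R using (_:+_; _:*_; _:=_)

  eval-cong : ∀ h {x y} → x ≈ y → eval h x ≈ eval h y
  eval-cong h x≈y = sum-cong-≋ {n} λ i → *-congˡ (φ-cong (toℕ i) x≈y)

  eval-+ : ∀ h x y → eval h (x + y) ≈ eval h x + eval h y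
  eval-+ h x y = trans
    (sum-cong-≋ λ i → trans (*-congˡ (φ-+ (toℕ i) x y)) (distribˡ (h i) _ _))
    (∑-distrib-+ (λ i → h i * φ (toℕ i) x) (λ i → h i * φ (toℕ i) y))

  eval-* : ∀ h {α β} → (∀ i → ¬ h i ≈ 0# → φ (toℕ i) α ≈ β) → ∀ x → eval h (α * x) ≈ β * eval h x
  eval-* h {α} {β} φα≈β x = trans (sum-cong-≋ term) (sym (*-distribˡ-sum β (λ i → h i * φ (toℕ i) x)))
    where
    term : ∀ i → h i * φ (toℕ i) (α * x) ≈ β * (h i * φ (toℕ i) x)
    term i with h i ≟ 0#
    ... | yes hi≈0 = trans (trans (*-congʳ hi≈0) (zeroˡ _))
                       (sym (trans (*-congˡ (trans (*-congʳ hi≈0) (zeroˡ _))) (zeroʳ β)))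
    ... | no hi≉0 = begin
      h i * φ (toℕ i) (α * x)            ≈⟨ *-congˡ (φ-* (toℕ i) α x) ⟩
      h i * (φ (toℕ i) α * φ (toℕ i) x)  ≈⟨ *-congˡ (*-congʳ (φα≈β i hi≉0)) ⟩
      h i * (β * φ (toℕ i) x)            ≈⟨ R.solve 3 (λ u β v → u :* (β :* v) := β :* (u :* v)) refl
                                              (h i) β (φ (toℕ i) x) ⟩
      β * (h i * φ (toℕ i) x)            ∎

  eval-Fixed₁ : ∀ h {μ} → Fixed 1 μ → ∀ x → eval h (μ * x) ≈ μ * eval h x
  eval-Fixed₁ h fμ = eval-* h λ i _ → trans (φ-≡ _ (≡.sym (ℕ.*-identityʳ (toℕ i)))) (Fixed-multiple (toℕ i) fμ)

  eval-0 : ∀ h → eval h 0# ≈ 0#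
  eval-0 h = sum-≈ε +-commutativeMonoid λ i → trans (*-congˡ (φ-0 (toℕ i))) (zeroʳ (h i))

  linearized-Poly : ∀ m (b : Fin (suc m) → Carrier) →
    Poly (b (fromℕ m)) (q ℕ.^ m) (λ x → sum λ i → b i * φ (toℕ i) x)
  linearized-Poly zero b = Poly-resp (*-identityʳ _) (λ x → sym (+-identityʳ _)) (Poly-scale (b zero) (Poly-^ 1))
  linearized-Poly (suc m) b = Poly-resp (*-identityʳ _) (λ x → begin
      b (fromℕ (suc m)) * φ (suc m) x + sum (λ i → b (inject₁ i) * φ (toℕ i) x)
        ≈⟨ +-comm _ _ ⟩
      sum (λ i → b (inject₁ i) * φ (toℕ i) x) + b (fromℕ (suc m)) * φ (suc m) x
        ≈⟨ +-cong (sum-cong-≋ {suc m} λ i → *-congˡ {x = b (inject₁ i)} (φ-≡ x (Fin.toℕ-inject₁ i)))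
                  (*-congˡ (φ-≡ x (Fin.toℕ-fromℕ (suc m)))) ⟨
      sum (λ i → b (inject₁ i) * φ (toℕ (inject₁ i)) x) + b (fromℕ (suc m)) * φ (toℕ (fromℕ (suc m))) x
        ≈⟨ sum-init-last (λ i → b i * φ (toℕ i) x) ⟨
      sum (λ i → b i * φ (toℕ i) x) ∎)
    (Poly-add-lower (Poly-scale (b (fromℕ (suc m))) (Poly-^ (q ℕ.^ suc m)))
      (linearized-Poly m (b ∘ inject₁)) (ℕ.^-monoʳ-< q 1<q (ℕ.n<1+n m)))

  -- A nonzero top coefficient would give a polynomial of degree q^(m-1) < q^n with q^n roots. So it
  -- vanishes, and the remaining coefficients follow by induction. Hence coefficients of exponents
  -- below n are determined by the function.
  linearized-zero : ∀ m → m ℕ.≤ n → (b : Fin m → Carrier) →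
    (∀ x → sum (λ i → b i * φ (toℕ i) x) ≈ 0#) → ∀ i → b i ≈ 0#
  linearized-zero (suc m) m<n b vanishes i with b (fromℕ m) ≟ 0#
  ... | no last≉0 = contradiction
          (root-bound-size {S = setoid} id id last≉0 (linearized-Poly m b) size vanishes)
          (ℕ.<⇒≱ (ℕ.^-monoʳ-< q 1<q m<n))
  ... | yes last≈0 with view i
  ...   | ‵fromℕ = last≈0
  ...   | ‵inject₁ j = linearized-zero m (ℕ.<⇒≤ m<n) (b ∘ inject₁) (λ x → begin
          sum (λ i → b (inject₁ i) * φ (toℕ i) x)
            ≈⟨ sum-cong-≋ {m} (λ i → *-congˡ (φ-≡ x (Fin.toℕ-inject₁ i))) ⟨
          sum (λ i → b (inject₁ i) * φ (toℕ (inject₁ i)) x)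
            ≈⟨ +-identityʳ _ ⟨
          sum (λ i → b (inject₁ i) * φ (toℕ (inject₁ i)) x) + 0#
            ≈⟨ +-congˡ (trans (*-congʳ last≈0) (zeroˡ _)) ⟨
          sum (λ i → b (inject₁ i) * φ (toℕ (inject₁ i)) x) + b (fromℕ m) * φ (toℕ (fromℕ m)) x
            ≈⟨ sum-init-last (λ i → b i * φ (toℕ i) x) ⟨
          sum (λ i → b i * φ (toℕ i) x)
            ≈⟨ vanishes x ⟩
          0# ∎) j

  -- The function h(αx) - β h(x) vanishes identically, and its coefficient at i is h i times the
  -- difference of φ i α and β.
  scaling-coefficients : ∀ h {α β} → (∀ x → eval h (α * x) ≈ β * eval h x) →
                         ∀ {i} → ¬ h i ≈ 0# → φ (toℕ i) α ≈ β
  scaling-coefficients h {α} {β} scaling {i} hi≉0 = *-cancelˡ (h i) hi≉0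
    (x∙y⁻¹≈ε⇒x≈y _ _ (begin
      h i * φ (toℕ i) α - h i * β      ≈⟨ +-congˡ (trans (-‿cong (*-comm (h i) β)) (-‿distribˡ-* β (h i))) ⟩
      h i * φ (toℕ i) α + - β * h i    ≈⟨ linearized-zero n ℕ.≤-refl b vanishes i ⟩
      0#                               ∎))
    where
    b : Fin n → Carrier
    b i = h i * φ (toℕ i) α + - β * h i
    vanishes : ∀ x → sum (λ i → b i * φ (toℕ i) x) ≈ 0#
    vanishes x = begin
      sum (λ i → b i * φ (toℕ i) x)
        ≈⟨ sum-cong-≋ (λ i → trans
             (R.solve 4 (λ u a γ v → (u :* a :+ γ :* u) :* v := u :* (a :* v) :+ γ :* (u :* v)) refl
               (h i) (φ (toℕ i) α) (- β) (φ (toℕ i) x))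
             (+-congʳ (*-congˡ (sym (φ-* (toℕ i) α x))))) ⟩
      sum (λ i → h i * φ (toℕ i) (α * x) + - β * (h i * φ (toℕ i) x))
        ≈⟨ ∑-distrib-+ (λ i → h i * φ (toℕ i) (α * x)) (λ i → - β * (h i * φ (toℕ i) x)) ⟩
      eval h (α * x) + sum (λ i → - β * (h i * φ (toℕ i) x))
        ≈⟨ +-congˡ (*-distribˡ-sum (- β) (λ i → h i * φ (toℕ i) x)) ⟨
      eval h (α * x) + - β * eval h x
        ≈⟨ +-congˡ (-‿distribˡ-* β (eval h x)) ⟨
      eval h (α * x) - β * eval h x
        ≈⟨ x≈y⇒x∙y⁻¹≈ε (scaling x) ⟩
      0# ∎

  -- Exponents of the support

  module _ (h : QPoly) where

    t∣n : t h ∣ n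
    t∣n = ∣foldr-gcd (Δ h) (here ≡.refl)

    0<t : 0 ℕ.< t h
    0<t = ℕ.>-nonZero⁻¹ (t h)

    t∣difference : ∀ {i j} → ¬ h i ≈ 0# → ¬ h j ≈ 0# → i ≢ j → t h ∣ (toℕ i ⊖ toℕ j) %ℕ n
    t∣difference hi≉0 hj≉0 i≢j = ∣foldr-gcd (Δ h) (there (∈-map⁺ _
      (∈-filter⁺ _ (∈-cartesianProduct⁺ (∈-allFin _) (∈-allFin _)) (*-≉0 hi≉0 hj≉0 , i≢j))))

    support-% : ∀ {i j} → ¬ h i ≈ 0# → ¬ h j ≈ 0# → toℕ i % t h ≡ toℕ j % t h
    support-% {i} {j} hi≉0 hj≉0 with i Fin.≟ j
    ... | yes ≡.refl = ≡.refl
    ... | no i≢j = let a , d+j≡i+an = ⊖-%ℕ n (Fin.toℕ<n i) (Fin.toℕ<n j) in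
      %-shift a (t∣difference hi≉0 hj≉0 i≢j) t∣n d+j≡i+an

    -- For d = (i - j) mod n, applying φ j to φ d x gives φ i x, as the n-th Frobenius power is
    -- trivial; by assumption this is φ j x, and injectivity of φ j leaves φ d x = x. The periods
    -- are then combined along the fold that defines t, starting from the trivial period 0.
    Fixed-t : ∀ {x} → (∀ {i j} → ¬ h i ≈ 0# → ¬ h j ≈ 0# → φ (toℕ i) x ≈ φ (toℕ j) x) → Fixed (t h) x
    Fixed-t {x} agree = Fixed-foldr (Δ h)
      (φ-n x ∷ All.map⁺ (All.map difference (All.all-filter _ (cartesianProduct (allFin n) (allFin n)))))
      where
      Fixed-foldr : ∀ xs → All (λ d → Fixed d x) xs → Fixed (foldr gcd 0 xs) x
      Fixed-foldr []       []         = *-identityʳ x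
      Fixed-foldr (d ∷ xs) (fd ∷ fxs) = Fixed-gcd d (foldr gcd 0 xs) fd (Fixed-foldr xs fxs)
      fixed : ∀ {i j} → φ (toℕ i) x ≈ φ (toℕ j) x → Fixed ((toℕ i ⊖ toℕ j) %ℕ n) x
      fixed {i} {j} eq with ⊖-%ℕ n (Fin.toℕ<n i) (Fin.toℕ<n j)
      ... | a , d+j≡i+an = φ-injective (toℕ j) (begin
        φ (toℕ j) (φ ((toℕ i ⊖ toℕ j) %ℕ n) x)      ≈⟨ φ-∘ (toℕ j) ((toℕ i ⊖ toℕ j) %ℕ n) x ⟩
        φ ((toℕ i ⊖ toℕ j) %ℕ n ℕ.+ toℕ j) x        ≈⟨ φ-≡ x d+j≡i+an ⟩
        φ (toℕ i ℕ.+ a ℕ.* n) x                     ≈⟨ φ-+multiple (φ-n x) (toℕ i) a ⟩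
        φ (toℕ i) x                                 ≈⟨ eq ⟩
        φ (toℕ j) x                                 ∎)
      difference : ∀ {(i , j) : Fin n × Fin n} → ¬ h i * h j ≈ 0# × i ≢ j → Fixed ((toℕ i ⊖ toℕ j) %ℕ n) x
      difference {i , j} (hihj≉0 , _) = fixed {i} {j} (agree
        (λ hi≈0 → hihj≉0 (trans (*-congʳ hi≈0) (zeroˡ _)))
        (λ hj≈0 → hihj≉0 (trans (*-congˡ hj≈0) (zeroʳ _))))

    support-φ : ∀ {i j α} → ¬ h i ≈ 0# → ¬ h j ≈ 0# → Fixed (t h) α → φ (toℕ i) α ≈ φ (toℕ j) α
    support-φ {i} {j} {α} hi≉0 hj≉0 fα = trans (φ-% {t h} fα (toℕ i))
      (trans (φ-≡ α (support-% hi≉0 hj≉0)) (sym (φ-% {t h} fα (toℕ j))))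

    -- All exponents of the support send α to the same β.
    scaling⇒Fixed : ∀ {α β} → (∀ x → eval h (α * x) ≈ β * eval h x) → Fixed (t h) α
    scaling⇒Fixed scaling = Fixed-t λ hi≉0 hj≉0 →
      trans (scaling-coefficients h scaling hi≉0) (sym (scaling-coefficients h scaling hj≉0))

    Fixed⇒scaling : ∀ {i α} → ¬ h i ≈ 0# → Fixed (t h) α →
                    ∀ x → eval h (α * x) ≈ φ (toℕ i) α * eval h x
    Fixed⇒scaling hi≉0 fα = eval-* h λ j hj≉0 → support-φ hj≉0 hi≉0 fα

-- Scattered polynomials and the stabilizers of their graphs.

/-mono-< : ∀ {i n t} .{{_ : NonZero t}} → i ℕ.< n → t ∣ n → i / t ℕ.< n / t
/-mono-< {i} {n} {t} i<n t∣n = ℕ.*-cancelʳ-< t (i / t) (n / t)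
  (ℕ.≤-<-trans (m/n*n≤m i t) (≡.subst (i ℕ.<_) (≡.sym (m/n*n≡m t∣n)) i<n))

module ScatteredPolynomial {ℓ₁ ℓ₂} (q n : ℕ) (q-prime-power : IsPrimePower q) .{{_ : NonTrivial n}}
                           (F : FiniteField ℓ₁ ℓ₂ (q ℕ.^ n))
                           (h : QPolynomials.QPoly q n F) (scattered : QPolynomials.Scattered q n F h) where
  open FiniteField F hiding (zero)
  open FieldProperties F
  open FixedFields q n q-prime-power F
  open QPolynomials q n F hiding (t)
  open QPolynomialProperties q n q-prime-power F
  open GroupProperties +-abelianGroup using (x∙y⁻¹≈ε⇒x≈y; x≈y⇒x∙y⁻¹≈ε; ∙-cancelʳ; ∙-cancelˡ)
  open Exp commutativeSemiring using (^-congʳ)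
  open import Relation.Binary.Reasoning.Setoid setoid
  private
    module R = Solver commutativeSemiring
    open R using (_:+_; _:*_; _:=_)
    module Mat = Setoid matSetoid

  H : Carrier → Carrier
  H = eval h

  proportional⇒dependent : ∀ {y z} → z * H y ≈ y * H z → LinearlyDependent y z
  proportional⇒dependent zHy≈yHz = scattered _ _ (x≈y⇒x∙y⁻¹≈ε zHy≈yHz)

  n≰1 : ¬ n ℕ.≤ 1
  n≰1 = ℕ.<⇒≱ (ℕ.nonTrivial⇒n>1 n)

  -- By scatteredness every x fixed by φ k depends on 1, hence lies in F_q. Taking k = n shows that
  -- h is not zero, and k = t that s is not 0.
  dependent-Fixed⇒≤1 : ∀ {k} → k ∣ n → 0 ℕ.< k → (∀ {x} → Fixed k x → x * H 1# ≈ 1# * H x) → k ℕ.≤ 1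
  dependent-Fixed⇒≤1 k∣n 0<k proportional = Fixed-nested k∣n 0<k (s≤s z≤n) λ fx →
    let μ , fμ , x≈μ1 = dependent⇒multiple (proportional⇒dependent (proportional fx)) 1≉0
    in Fixed-resp 1 (sym (trans x≈μ1 (*-identityʳ μ))) fμ

  nonzero-coefficient : ∃ λ i → ¬ h i ≈ 0#
  nonzero-coefficient with Fin.any? (λ i → ¬? (h i ≟ 0#))
  ... | yes found = found
  ... | no none = contradiction (dependent-Fixed⇒≤1 ∣-refl (ℕ.>-nonZero⁻¹ n) λ {x} _ →
          trans (trans (*-congˡ (H≈0 1#)) (zeroʳ x)) (sym (trans (*-congˡ (H≈0 x)) (zeroʳ 1#)))) n≰1
    where
    h≈0 : ∀ i → h i ≈ 0#
    h≈0 i with h i ≟ 0#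
    ... | yes hi≈0 = hi≈0
    ... | no hi≉0 = contradiction (i , hi≉0) none
    H≈0 : ∀ x → H x ≈ 0#
    H≈0 x = sum-≈ε +-commutativeMonoid λ i → trans (*-congʳ (h≈0 i)) (zeroˡ _)

  -- The image of L and its kernel both lie on a single F_q-line, as scatteredness applies
  -- to the constant slope κ on the image and to the constant slope −α/c on the kernel.
  eigenvector⇒≤2 : ∀ α c κ → ¬ c ≈ 0# →
    (∀ x → H (α * x + c * H x) ≈ κ * (α * x + c * H x)) → n ℕ.≤ 2
  eigenvector⇒≤2 α c κ c≉0 eigen = rank-nullity-≤2 L L-cong L-+ L-*
    (λ x y → proportional⇒dependent (begin
      L y * H (L x)    ≈⟨ *-congˡ (eigen x) ⟩
      L y * (κ * L x)  ≈⟨ R.solve 3 (λ x κ y → y :* (κ :* x) := x :* (κ :* y)) refl (L x) κ (L y) ⟩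
      L x * (κ * L y)  ≈⟨ *-congˡ (eigen y) ⟨
      L x * H (L y)    ∎))
    (λ {x} {y} Lx≈0 Ly≈0 → proportional⇒dependent (*-cancelˡ c c≉0 (∙-cancelˡ (α * x * y) _ _ (begin
      α * x * y + c * (y * H x)    ≈⟨ R.solve 5 (λ α c x y hx →
                                        α :* x :* y :+ c :* (y :* hx) := y :* (α :* x :+ c :* hx)) refl α c x y (H x) ⟩
      y * L x                      ≈⟨ trans (*-congˡ Lx≈0) (zeroʳ y) ⟩
      0#                           ≈⟨ trans (*-congˡ Ly≈0) (zeroʳ x) ⟨
      x * L y                      ≈⟨ R.solve 5 (λ α c x y hy →
                                        α :* x :* y :+ c :* (x :* hy) := x :* (α :* y :+ c :* hy)) refl α c x y (H y) ⟨
      α * x * y + c * (x * H y)    ∎))))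
    where
    L : Carrier → Carrier
    L x = α * x + c * H x
    L-cong : ∀ {x y} → x ≈ y → L x ≈ L y
    L-cong x≈y = +-cong (*-congˡ x≈y) (*-congˡ (eval-cong h x≈y))
    L-+ : ∀ x y → L (x + y) ≈ L x + L y
    L-+ x y = trans (+-congˡ (*-congˡ (eval-+ h x y)))
      (R.solve 6 (λ α c x y hx hy → α :* (x :+ y) :+ c :* (hx :+ hy) :=
        (α :* x :+ c :* hx) :+ (α :* y :+ c :* hy)) refl α c x y (H x) (H y))
    L-* : ∀ {μ} → Fixed 1 μ → ∀ x → L (μ * x) ≈ μ * L x
    L-* {μ} fμ x = trans (+-congˡ (*-congˡ (eval-Fixed₁ h fμ x)))
      (R.solve 5 (λ α c μ x hx → α :* (μ :* x) :+ c :* (μ :* hx) := μ :* (α :* x :+ c :* hx)) refl α c μ x (H x))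

  -- Matrices stabilizing the graph

  stabilizer-equation : ∀ {A} → A ∈ G h → ∀ x →
    H (A 0F 0F * x + A 1F 0F * H x) ≈ A 0F 1F * x + A 1F 1F * H x
  stabilizer-equation {A} (_ , image⊆U , _) x
    with image⊆U {v · A} (v , (x , λ { 0F → refl ; 1F → refl }) , λ _ → refl)
    where
    v : Vec₂
    v 0F = x
    v 1F = H x
  ... | x′ , vA≈ = begin
    H (A 0F 0F * x + A 1F 0F * H x)      ≈⟨ eval-cong h (trans (sym (column 0F)) (vA≈ 0F)) ⟩
    H x′                                 ≈⟨ vA≈ 1F ⟨
    x * A 0F 1F + (H x * A 1F 1F + 0#)   ≈⟨ column 1F ⟩
    A 0F 1F * x + A 1F 1F * H x          ∎
    where
    column : ∀ j → x * A 0F j + (H x * A 1F j + 0#) ≈ A 0F j * x + A 1F j * H x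
    column j = +-cong (*-comm x _) (trans (+-identityʳ _) (*-comm (H x) _))

  -- Semilinear scattered polynomials

  module Semilinear {t s} (t∣n : t ∣ n) (0<t : 0 ℕ.< t) (1<t : 1 ℕ.< t) (s<t : s ℕ.< t)
                    (H-semilinear : ∀ {α} → Fixed t α → ∀ x → H (α * x) ≈ φ s α * H x)
                    (scaling-factor : ∀ {α β} → (∀ x → H (α * x) ≈ β * H x) → β ≈ φ s α) where

    σ : Carrier → Carrier
    σ = φ s

    0<s : 0 ℕ.< s
    0<s = ℕ.n≢0⇒n>0 λ s≡0 → ℕ.<⇒≱ 1<t (dependent-Fixed⇒≤1 t∣n 0<t λ {x} fx → begin
      x * H 1#        ≈⟨ *-congʳ (trans (φ-≡ x s≡0) (*-identityʳ x)) ⟨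
      σ x * H 1#      ≈⟨ H-semilinear fx 1# ⟨
      H (x * 1#)      ≈⟨ eval-cong h (*-identityʳ x) ⟩
      H x             ≈⟨ *-identityˡ _ ⟨
      1# * H x        ∎)

    -- Otherwise φ s would fix the whole field of order q^t, although 0 < s < t.
    moved : ∃ λ μ → Fixed t μ × ¬ σ μ ≈ μ
    moved with any? {P = λ μ → Fixed t μ × ¬ σ μ ≈ μ}
                 (λ x≈y (fx , σx≉x) → Fixed-resp t x≈y fx , λ σy≈y → σx≉x (Fixed-resp s (sym x≈y) σy≈y))
                 (λ μ → (φ t μ ≟ μ) ×-dec ¬? (σ μ ≟ μ))
    ... | yes found = found
    ... | no none = contradiction
          (Fixed-nested t∣n 0<t 0<s (λ {x} fx → fixed x fx)) (ℕ.<⇒≱ s<t)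
      where
      fixed : ∀ x → Fixed t x → σ x ≈ x
      fixed x fx with σ x ≟ x
      ... | yes σx≈x = σx≈x
      ... | no σx≉x = contradiction (x , fx , σx≉x) none

    μ : Carrier
    μ = proj₁ moved

    fμ : Fixed t μ
    fμ = proj₁ (proj₂ moved)

    σμ≉μ : ¬ σ μ ≈ μ
    σμ≉μ = proj₂ (proj₂ moved)

    -- The difference of two equations that share u and w. These will be the terms of the diagonal
    -- entries a and d: twisting by μ multiplies both by σ μ, exactly as multiplying the untwisted
    -- equation by σ μ does.
    eliminate : ∀ {u v w m m′ v′} → u + m ≈ v + w → u + m′ ≈ v′ + w → m + v′ ≈ v + m′
    eliminate {u} {v} {w} {m} {m′} {v′} eq eq′ = ∙-cancelʳ (u + w) _ _ (begin
      (m + v′) + (u + w)     ≈⟨ R.solve 4 (λ m v′ u w → (m :+ v′) :+ (u :+ w) := (u :+ m) :+ (v′ :+ w)) refl m v′ u w ⟩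
      (u + m) + (v′ + w)     ≈⟨ +-cong eq (sym eq′) ⟩
      (v + w) + (u + m′)     ≈⟨ R.solve 4 (λ v w u m′ → (v :+ w) :+ (u :+ m′) := (v :+ m′) :+ (u :+ w)) refl v w u m′ ⟩
      (v + m′) + (u + w)     ∎)

    -- Collects the terms in u and in v. For j, k, l equal to σ(σ μ), σ μ, μ it isolates h(c h(x))
    -- against b x.
    cross-difference : ∀ {j k l u v} → j * u + k * v ≈ l * v + k * u → (j - k) * u ≈ (l - k) * v
    cross-difference {j} {k} {l} {u} {v} eq = begin
      (j - k) * u                                   ≈⟨ +-identityʳ _ ⟨
      (j - k) * u + 0#                              ≈⟨ +-congˡ (trans (*-congʳ (-‿inverseʳ k)) (zeroˡ v)) ⟨
      (j - k) * u + (k - k) * v                     ≈⟨ R.solve 5 (λ j k m u v → (j :+ m) :* u :+ (k :+ m) :* v :=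
                                                         (j :* u :+ k :* v) :+ m :* (u :+ v)) refl j k (- k) u v ⟩
      (j * u + k * v) + - k * (u + v)               ≈⟨ +-congʳ eq ⟩
      (l * v + k * u) + - k * (u + v)               ≈⟨ R.solve 5 (λ l k m u v → (l :* v :+ k :* u) :+ m :* (u :+ v) :=
                                                         (l :+ m) :* v :+ (k :+ m) :* u) refl l k (- k) u v ⟩
      (l - k) * v + (k - k) * u                     ≈⟨ +-congˡ (trans (*-congʳ (-‿inverseʳ k)) (zeroˡ u)) ⟩
      (l - k) * v + 0#                              ≈⟨ +-identityʳ _ ⟩
      (l - k) * v                                   ∎

    -- Replacing x by μ x multiplies h(ax), h(ch(x)), bx, dh(x) by σμ, σ²μ, μ, σμ respectively,
    -- which separates the four terms.
    module Separation {a b c d} (equation : ∀ x → H (a * x + c * H x) ≈ b * x + d * H x) where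

      split : ∀ x → H (a * x) + H (c * H x) ≈ b * x + d * H x
      split x = trans (sym (eval-+ h (a * x) (c * H x))) (equation x)

      H-ax : ∀ {α} → Fixed t α → ∀ x → H (a * (α * x)) ≈ σ α * H (a * x)
      H-ax {α} fα x = trans (eval-cong h (R.solve 3 (λ a α x → a :* (α :* x) := α :* (a :* x)) refl a α x))
        (H-semilinear fα (a * x))

      H-cHx : ∀ {α} → Fixed t α → ∀ x → H (c * H (α * x)) ≈ σ (σ α) * H (c * H x)
      H-cHx {α} fα x = begin
        H (c * H (α * x))         ≈⟨ eval-cong h (*-congˡ (H-semilinear fα x)) ⟩
        H (c * (σ α * H x))       ≈⟨ eval-cong h (R.solve 3 (λ c s y → c :* (s :* y) := s :* (c :* y)) refl c (σ α) (H x)) ⟩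
        H (σ α * (c * H x))       ≈⟨ H-semilinear (Fixed-φ t s fα) (c * H x) ⟩
        σ (σ α) * H (c * H x)     ∎

      split-scaled : ∀ {α} → Fixed t α → ∀ x →
        σ α * H (a * x) + σ (σ α) * H (c * H x) ≈ α * (b * x) + σ α * (d * H x)
      split-scaled {α} fα x = begin
        σ α * H (a * x) + σ (σ α) * H (c * H x)   ≈⟨ +-cong (H-ax fα x) (H-cHx fα x) ⟨
        H (a * (α * x)) + H (c * H (α * x))       ≈⟨ split (α * x) ⟩
        b * (α * x) + d * H (α * x)               ≈⟨ +-cong
          (R.solve 3 (λ b α x → b :* (α :* x) := α :* (b :* x)) refl b α x)
          (trans (*-congˡ (H-semilinear fα x))
            (R.solve 3 (λ d s y → d :* (s :* y) := s :* (d :* y)) refl d (σ α) (H x))) ⟩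
        α * (b * x) + σ α * (d * H x)             ∎

      scaled-split : ∀ α x → α * H (a * x) + α * H (c * H x) ≈ α * (b * x) + α * (d * H x)
      scaled-split α x = trans (sym (distribˡ α _ _)) (trans (*-congˡ (split x)) (distribˡ α _ _))

      η : Carrier
      η = σ (σ μ) - σ μ

      η≉0 : ¬ η ≈ 0#
      η≉0 η≈0 = σμ≉μ (φ-injective s (x∙y⁻¹≈ε⇒x≈y _ _ η≈0))

      -- After elimination, (σ(σ μ) - σ μ) h(c h(x)) = (μ - σ μ) b x. The left factor `η` can be
      -- divided out since σ is injective and moves μ.
      linear : ∃ λ κ → ∀ x → H (c * H x) ≈ κ * x
      linear = η⁻¹ * (μ - σ μ) * b , λ x → *-cancelˡ η η≉0 (begin
        η * H (c * H x)                 ≈⟨ cross-difference (eliminate (split-scaled fμ x) (scaled-split (σ μ) x)) ⟩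
        (μ - σ μ) * (b * x)             ≈⟨ *-identityˡ _ ⟨
        1# * ((μ - σ μ) * (b * x))      ≈⟨ *-congʳ ηη⁻¹≈1 ⟨
        η * η⁻¹ * ((μ - σ μ) * (b * x)) ≈⟨ R.solve 5 (λ e e′ m b x →
            e :* e′ :* (m :* (b :* x)) := e :* (e′ :* m :* b :* x)) refl η η⁻¹ (μ - σ μ) b x ⟩
        η * (η⁻¹ * (μ - σ μ) * b * x)   ∎)
        where
        η⁻¹ = proj₁ (inverse η η≉0)
        ηη⁻¹≈1 : η * η⁻¹ ≈ 1#
        ηη⁻¹≈1 = proj₂ (inverse η η≉0)

      -- Twisting by μ multiplies h(c h(x)) by σ(σ μ), but it multiplies κ x by μ. Putting this into
      -- the eliminated equation at x = 1 turns it into (σ μ - μ)(κ - b) = 0.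
      slope≈b : ∀ {κ} → (∀ x → H (c * H x) ≈ κ * x) → κ ≈ b
      slope≈b {κ} HcH≈κ = conclude (*-cancelʳ-⊎ (κ - b) twisted)
        where
        HcH[μ] : σ (σ μ) * H (c * H 1#) ≈ μ * κ
        HcH[μ] = begin
          σ (σ μ) * H (c * H 1#)    ≈⟨ H-cHx fμ 1# ⟨
          H (c * H (μ * 1#))        ≈⟨ HcH≈κ (μ * 1#) ⟩
          κ * (μ * 1#)              ≈⟨ *-congˡ (*-identityʳ μ) ⟩
          κ * μ                     ≈⟨ *-comm κ μ ⟩
          μ * κ                     ∎
        crossed : μ * κ + σ μ * b ≈ μ * b + σ μ * κ
        crossed = begin
          μ * κ + σ μ * b                                ≈⟨ +-cong HcH[μ] (*-congˡ (*-identityʳ b)) ⟨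
          σ (σ μ) * H (c * H 1#) + σ μ * (b * 1#)        ≈⟨ eliminate (split-scaled fμ 1#) (scaled-split (σ μ) 1#) ⟩
          μ * (b * 1#) + σ μ * H (c * H 1#)              ≈⟨ +-cong (*-congˡ (*-identityʳ b))
                                                              (*-congˡ (trans (HcH≈κ 1#) (*-identityʳ κ))) ⟩
          μ * b + σ μ * κ                                ∎
        twisted : σ μ * (κ - b) ≈ μ * (κ - b)
        twisted = begin
          σ μ * (κ - b)                ≈⟨ *-comm (σ μ) (κ - b) ⟩
          (κ - b) * σ μ                ≈⟨ cross-difference (begin
            κ * σ μ + b * μ               ≈⟨ +-comm _ _ ⟩
            b * μ + κ * σ μ               ≈⟨ +-cong (*-comm b μ) (*-comm κ (σ μ)) ⟩
            μ * b + σ μ * κ               ≈⟨ crossed ⟨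
            μ * κ + σ μ * b               ≈⟨ +-cong (*-comm μ κ) (*-comm (σ μ) b) ⟩
            κ * μ + b * σ μ               ∎) ⟩
          (κ - b) * μ                  ≈⟨ *-comm (κ - b) μ ⟩
          μ * (κ - b)                  ∎
        conclude : σ μ ≈ μ ⊎ κ - b ≈ 0# → κ ≈ b
        conclude (inj₁ σμ≈μ)  = contradiction σμ≈μ σμ≉μ
        conclude (inj₂ κ-b≈0) = x∙y⁻¹≈ε⇒x≈y κ b κ-b≈0

      HcH≈b : ∀ x → H (c * H x) ≈ b * x
      HcH≈b x = let κ , HcH≈κ = linear in trans (HcH≈κ x) (*-congʳ (slope≈b HcH≈κ))

    -- If h(ch(x)) = bx with b, c nonzero, then σ is an involution on the field of order q^t,
    -- whose fixed field contains bc. As the norm of that extension is onto, bc = α σ(α), and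
    -- α x + c h(x) is an eigenvector of h for every x.
    module Involution {b c} (b≉0 : ¬ b ≈ 0#) (c≉0 : ¬ c ≈ 0#) (HcH≈b : ∀ x → H (c * H x) ≈ b * x) where

      -- At α, the composite h(c h(x)) is σ(σ α) times its value b at 1 by semilinearity, and also b
      -- α by hypothesis.
      σσ : ∀ {α} → Fixed t α → σ (σ α) ≈ α
      σσ {α} fα = *-cancelʳ (b * 1#) (*-≉0 b≉0 1≉0) (begin
        σ (σ α) * (b * 1#)          ≈⟨ *-congˡ (HcH≈b 1#) ⟨
        σ (σ α) * H (c * H 1#)      ≈⟨ H-semilinear (Fixed-φ t s fα) (c * H 1#) ⟨
        H (σ α * (c * H 1#))        ≈⟨ eval-cong h (R.solve 3 (λ c s y → c :* (s :* y) := s :* (c :* y)) refl c (σ α) (H 1#)) ⟨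
        H (c * (σ α * H 1#))        ≈⟨ eval-cong h (*-congˡ (H-semilinear fα 1#)) ⟨
        H (c * H (α * 1#))          ≈⟨ HcH≈b (α * 1#) ⟩
        b * (α * 1#)                ≈⟨ R.solve 3 (λ b α x → b :* (α :* x) := α :* (b :* x)) refl b α 1# ⟩
        α * (b * 1#)                ∎)

      t≤s+s : t ℕ.≤ s ℕ.+ s
      t≤s+s = Fixed-nested t∣n 0<t (ℕ.<-≤-trans 0<s (ℕ.m≤m+n s s)) λ {x} fx → trans (sym (φ-∘ s s x)) (σσ fx)

      -- If t < 2s, then φ (2s - t) would also fix the field of order q^t, although 0 < 2s - t < t.
      t≮s+s : ¬ t ℕ.< s ℕ.+ s
      t≮s+s t<s+s = ℕ.<⇒≱ r<t (Fixed-nested t∣n 0<t (ℕ.m<n⇒0<n∸m t<s+s) λ {x} fx → begin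
        φ r x              ≈⟨ φ-cong r fx ⟨
        φ r (φ t x)        ≈⟨ φ-∘ r t x ⟩
        φ (t ℕ.+ r) x      ≈⟨ φ-≡ x t+r≡s+s ⟩
        φ (s ℕ.+ s) x      ≈⟨ φ-∘ s s x ⟨
        σ (σ x)            ≈⟨ σσ fx ⟩
        x                  ∎)
        where
        r = s ℕ.+ s ℕ.∸ t
        t+r≡s+s : t ℕ.+ r ≡ s ℕ.+ s
        t+r≡s+s = ℕ.m+[n∸m]≡n (ℕ.<⇒≤ t<s+s)
        r<t : r ℕ.< t
        r<t = ℕ.+-cancelˡ-< t r t (≡.subst (ℕ._< t ℕ.+ t) (≡.sym t+r≡s+s) (ℕ.+-mono-< s<t s<t))

      t≡s+s : t ≡ s ℕ.+ s
      t≡s+s = ℕ.≤-antisym t≤s+s (ℕ.≮⇒≥ t≮s+s)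

      w : Carrier
      w = b * c

      w≉0 : ¬ w ≈ 0#
      w≉0 = *-≉0 b≉0 c≉0

      -- h(c h(c h(x))) is evaluated twice, once from the inside and once from the outside. Since bc
      -- scales h by itself, `scaling-factor` will give σ(bc) = bc.
      w-scaling : ∀ x → H (w * x) ≈ w * H x
      w-scaling x = begin
        H (b * c * x)           ≈⟨ eval-cong h (R.solve 3 (λ b c x → b :* c :* x := c :* (b :* x)) refl b c x) ⟩
        H (c * (b * x))         ≈⟨ eval-cong h (*-congˡ (HcH≈b x)) ⟨
        H (c * H (c * H x))     ≈⟨ HcH≈b (c * H x) ⟩
        b * (c * H x)           ≈⟨ *-assoc b c (H x) ⟨
        b * c * H x             ∎

      -- α σ(α) is α^(Q+1) with Q = q^s, so nonzero solutions of x^(Q+1) = w are sought in the field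
      -- of order q^t = Q^2.
      norm-onto : ∃ λ α → ¬ α ≈ 0# × Fixed t α × α * σ α ≈ w
      norm-onto = norm-solution (q ℕ.^ s) ≡.refl (1<q^ 0<s)
        where
        norm-solution : ∀ Q → Q ≡ q ℕ.^ s → 1 ℕ.< Q → ∃ λ α → ¬ α ≈ 0# × Fixed t α × α * σ α ≈ w
        norm-solution (suc zero) _ (s≤s ())
        norm-solution (suc (suc m)) Q≡qˢ _ =
          -- Here M = Q + 1 and `suc m` = Q - 1, so the exponent M (Q - 1) is Q^2 - 1, which kills
          -- every nonzero element of the field of order q^t.
          let k , sizeP , L≤ = power-count {S = subsetoid setoid (Fixed t)} proj₁ id id
                (Fixed-size t∣n 0<t) {suc Q} {m} {w} (s≤s z≤n) w^≈1 λ (x , fx) → x^≈x fx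
          -- Since Q^2 = (4 + m) + m (Q + 1), there are at least 4 + m solutions of x^(Q+2) = w x.
          -- Two already suffice, because at most one of them is 0.
          in pick sizeP (ℕ.≤-trans (s≤s (s≤s z≤n)) (ℕ.+-cancelʳ-≤ (m ℕ.* suc Q) (4 ℕ.+ m) k
               (≡.subst (ℕ._≤ k ℕ.+ m ℕ.* suc Q) qᵗ≡ L≤)))
          where
          Q = suc (suc m)
          Q*Q≡qᵗ : Q ℕ.* Q ≡ q ℕ.^ t
          Q*Q≡qᵗ = ≡.trans (≡.cong₂ ℕ._*_ Q≡qˢ Q≡qˢ)
            (≡.trans (≡.sym (ℕ.^-distribˡ-+-* q s s)) (≡.cong (q ℕ.^_) (≡.sym t≡s+s)))
          qᵗ≡ : q ℕ.^ t ≡ (4 ℕ.+ m) ℕ.+ m ℕ.* suc Q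
          qᵗ≡ = ≡.trans (≡.sym Q*Q≡qᵗ) (solve 1 (λ m → (con 2 :+ℕ m) :*ℕ (con 2 :+ℕ m) :=ℕ
                  (con 4 :+ℕ m) :+ℕ m :*ℕ (con 3 :+ℕ m)) ≡.refl m)
            where open +-*-Solver renaming (_:+_ to _:+ℕ_; _:*_ to _:*ℕ_; _:=_ to _:=ℕ_)
          -- w · w^(Q-1) = w^Q = σ w = w, and w is cancelled.
          w^≈1 : w ^ suc m ≈ 1#
          w^≈1 = *-cancelˡ w w≉0 (trans (^-congʳ w Q≡qˢ)
            (trans (sym (scaling-factor w-scaling)) (sym (*-identityʳ w))))
          x^≈x : ∀ {x} → Fixed t x → x ^ (suc Q ℕ.* suc m) * x ≈ x
          x^≈x {x} fx = trans (*-comm _ x) (trans (^-congʳ x (≡.trans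
            (solve 1 (λ m → con 1 :+ℕ (con 3 :+ℕ m) :*ℕ (con 1 :+ℕ m) :=ℕ (con 2 :+ℕ m) :*ℕ (con 2 :+ℕ m)) ≡.refl m)
            Q*Q≡qᵗ)) fx)
            where open +-*-Solver renaming (_:+_ to _:+ℕ_; _:*_ to _:*ℕ_; _:=_ to _:=ℕ_)
          nonzero : ∀ {x} → Fixed t x → x ^ suc Q * x ≈ w * x → ¬ x ≈ 0# →
                    ∃ λ α → ¬ α ≈ 0# × Fixed t α × α * σ α ≈ w
          nonzero {x} fx eq x≉0 = x , x≉0 , fx ,
            trans (*-congˡ (^-congʳ x (≡.sym Q≡qˢ))) (*-cancelʳ x x≉0 eq)
          pick : ∀ {k} → HasSize (subsetoid (subsetoid setoid (Fixed t)) λ (x , _) → x ^ suc Q * x ≈ w * x) k →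
                 2 ℕ.≤ k → ∃ λ α → ¬ α ≈ 0# × Fixed t α × α * σ α ≈ w
          pick {suc zero} _ (s≤s ())
          pick {suc (suc k)} sizeP _ = choose (value 0F ≉?0) (value 1F ≉?0)
            where
            value : Fin (suc (suc k)) → Carrier
            value i = proj₁ (proj₁ (Inverse.from sizeP i))
            solution : ∀ i → ¬ value i ≈ 0# → ∃ λ α → ¬ α ≈ 0# × Fixed t α × α * σ α ≈ w
            solution i = nonzero (proj₂ (proj₁ (Inverse.from sizeP i))) (proj₂ (Inverse.from sizeP i))
            choose : value 0F ≈ 0# ⊎ ¬ value 0F ≈ 0# → value 1F ≈ 0# ⊎ ¬ value 1F ≈ 0# →
                     ∃ λ α → ¬ α ≈ 0# × Fixed t α × α * σ α ≈ w
            choose (inj₂ x≉0) _          = solution 0F x≉0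
            choose (inj₁ _)   (inj₂ y≉0) = solution 1F y≉0
            choose (inj₁ x≈0) (inj₁ y≈0) =
              contradiction (from-injective _ sizeP {0F} {1F} (trans x≈0 (sym y≈0))) λ ()

      -- h maps α x + c h(x) to σ(α) h(x) + b x. This is a constant multiple of α x + c h(x) as soon
      -- as σ(α) / c = b / α, which is the norm condition; the slope is then b / α.
      norm⇒≤2 : ∀ {α} → ¬ α ≈ 0# → Fixed t α → α * σ α ≈ w → n ℕ.≤ 2
      norm⇒≤2 {α} α≉0 fα ασα≈w = eigenvector⇒≤2 α c (α⁻¹ * b) c≉0 λ x → begin
        H (α * x + c * H x)                              ≈⟨ eval-+ h (α * x) (c * H x) ⟩
        H (α * x) + H (c * H x)                          ≈⟨ +-cong (H-semilinear fα x) (HcH≈b x) ⟩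
        σ α * H x + b * x                                ≈⟨ *-identityˡ _ ⟨
        1# * (σ α * H x + b * x)                         ≈⟨ *-congʳ (proj₂ (inverse α α≉0)) ⟨
        α * α⁻¹ * (σ α * H x + b * x)                    ≈⟨ R.solve 6 (λ α α⁻¹ s y b x →
          α :* α⁻¹ :* (s :* y :+ b :* x) := α⁻¹ :* (b :* (α :* x) :+ α :* s :* y)) refl α α⁻¹ (σ α) (H x) b x ⟩
        α⁻¹ * (b * (α * x) + α * σ α * H x)              ≈⟨ *-congˡ (+-congˡ (*-congʳ ασα≈w)) ⟩
        α⁻¹ * (b * (α * x) + b * c * H x)                ≈⟨ R.solve 6 (λ α α⁻¹ b c x y →
          α⁻¹ :* (b :* (α :* x) :+ b :* c :* y) := α⁻¹ :* b :* (α :* x :+ c :* y)) refl α α⁻¹ b c x (H x) ⟩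
        α⁻¹ * b * (α * x + c * H x)                      ∎
        where α⁻¹ = proj₁ (inverse α α≉0)

      n≤2 : n ℕ.≤ 2
      n≤2 = let α , α≉0 , fα , ασα≈w = norm-onto in norm⇒≤2 α≉0 fα ασα≈w

    all-diagonal : n ≢ 2 → ∀ A → A ∈ G h → IsDiagonal A
    all-diagonal n≢2 A A∈G = λ where
        0F 0F i≢i → contradiction ≡.refl i≢i
        0F 1F _ → b≈0
        1F 0F _ → c≈0
        1F 1F i≢i → contradiction ≡.refl i≢i
      where
      a = A 0F 0F
      b = A 0F 1F
      c = A 1F 0F
      d = A 1F 1F
      open Separation {a} {b} {c} {d} (stabilizer-equation {A} A∈G)
      n≰2 : ¬ n ℕ.≤ 2
      n≰2 n≤2 = n≢2 (ℕ.≤-antisym n≤2 (ℕ.nonTrivial⇒n>1 n))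
      c≈0 : c ≈ 0#
      c≈0 with c ≟ 0# | b ≟ 0#
      ... | yes c≈0 | _ = c≈0
      ... | no c≉0 | no b≉0 = contradiction (Involution.n≤2 b≉0 c≉0 HcH≈b) n≰2
      ... | no c≉0 | yes b≈0 = contradiction (eigenvector⇒≤2 0# c 0# c≉0 λ x → begin
        H (0# * x + c * H x)     ≈⟨ eval-cong h (trans (+-congʳ (zeroˡ x)) (+-identityˡ _)) ⟩
        H (c * H x)              ≈⟨ HcH≈b x ⟩
        b * x                    ≈⟨ trans (*-congʳ b≈0) (zeroˡ x) ⟩
        0#                       ≈⟨ zeroˡ _ ⟨
        0# * (0# * x + c * H x)  ∎) n≰2
      b≈0 : b ≈ 0#
      b≈0 = begin
        b                ≈⟨ *-identityʳ b ⟨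
        b * 1#           ≈⟨ HcH≈b 1# ⟨
        H (c * H 1#)     ≈⟨ eval-cong h (trans (*-congʳ c≈0) (zeroˡ _)) ⟩
        H 0#             ≈⟨ eval-0 h ⟩
        0#               ∎

  -- Diagonal stabilizers

  private
    t = QPolynomials.t q n F h

  diagonal-scaling : ∀ {A} → A ∈ G h → IsDiagonal A → ∀ x → H (A 0F 0F * x) ≈ A 1F 1F * H x
  diagonal-scaling {A} A∈G diagonal x = begin
    H (A 0F 0F * x)                  ≈⟨ eval-cong h (trans (+-congˡ (trans (*-congʳ (diagonal 1F 0F λ ())) (zeroˡ _)))
                                          (+-identityʳ _)) ⟨
    H (A 0F 0F * x + A 1F 0F * H x)  ≈⟨ stabilizer-equation {A} A∈G x ⟩
    A 0F 1F * x + A 1F 1F * H x      ≈⟨ trans (+-congʳ (trans (*-congʳ (diagonal 0F 1F λ ())) (zeroˡ _)))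
                                          (+-identityˡ _) ⟩
    A 1F 1F * H x                    ∎

  scaling∈G : ∀ {α β A} → ¬ α ≈ 0# → ¬ β ≈ 0# → (∀ x → H (α * x) ≈ β * H x) →
              A Mat.≈ diag α β → A ∈ G h
  scaling∈G {α} {β} {A} α≉0 β≉0 scaling A≈ = det≉0 , image⊆U , U⊆image
    where
    det≉0 : ¬ det A ≈ 0#
    det≉0 det≈0 = *-≉0 α≉0 β≉0 (begin
      α * β                                  ≈⟨ *-cong (A≈ 0F 0F) (A≈ 1F 1F) ⟨
      A 0F 0F * A 1F 1F                      ≈⟨ x∙y⁻¹≈ε⇒x≈y _ _ det≈0 ⟩
      A 0F 1F * A 1F 0F                      ≈⟨ trans (*-congʳ (A≈ 0F 1F)) (zeroˡ _) ⟩
      0#                                     ∎)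
    column₀ : ∀ w → (w · A) 0F ≈ α * w 0F
    column₀ w = begin
      w 0F * A 0F 0F + (w 1F * A 1F 0F + 0#)   ≈⟨ +-cong (*-congˡ (A≈ 0F 0F)) (+-congʳ (*-congˡ (A≈ 1F 0F))) ⟩
      w 0F * α + (w 1F * 0# + 0#)              ≈⟨ R.solve 3 (λ α u v →
                                                    u :* α :+ (v :* R.con 0 :+ R.con 0) := α :* u) refl α (w 0F) (w 1F) ⟩
      α * w 0F                                 ∎
    column₁ : ∀ w → (w · A) 1F ≈ β * w 1F
    column₁ w = begin
      w 0F * A 0F 1F + (w 1F * A 1F 1F + 0#)   ≈⟨ +-cong (*-congˡ (A≈ 0F 1F)) (+-congʳ (*-congˡ (A≈ 1F 1F))) ⟩
      w 0F * 0# + (w 1F * β + 0#)              ≈⟨ R.solve 3 (λ β u v →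
                                                    u :* R.con 0 :+ (v :* β :+ R.con 0) := β :* v) refl β (w 0F) (w 1F) ⟩
      β * w 1F                                 ∎
    image⊆U : ∀ {v} → image (U h) A v → U h v
    image⊆U {v} (w , (x , w≈) , v≈wA) = α * x , λ where
      0F → trans (v≈wA 0F) (trans (column₀ w) (*-congˡ (w≈ 0F)))
      1F → trans (v≈wA 1F) (trans (column₁ w) (trans (*-congˡ (w≈ 1F)) (sym (scaling x))))
    U⊆image : ∀ {v} → U h v → image (U h) A v
    U⊆image {v} (x , v≈) = w , (y , λ { 0F → refl ; 1F → refl }) , λ where
        0F → trans (v≈ 0F) (trans (sym αy≈x) (sym (column₀ w)))
        1F → trans (v≈ 1F) (trans (trans (eval-cong h (sym αy≈x)) (scaling y)) (sym (column₁ w)))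
      where
      α⁻¹ = proj₁ (inverse α α≉0)
      y = α⁻¹ * x
      αy≈x : α * y ≈ x
      αy≈x = trans (sym (*-assoc α α⁻¹ x)) (trans (*-congʳ (proj₂ (inverse α α≉0))) (*-identityˡ x))
      w : Vec₂
      w 0F = y
      w 1F = H y

  monomial-≡ : ∀ {a k} {i : Fin n} → toℕ i ≡ k → monomial a k i ≈ a
  monomial-≡ {a} {k} {i} i≡k =
    reflexive (≡.cong (λ u → if u then a else 0#) (dec-true (toℕ i ℕ.≟ k) i≡k))

  monomial-≢ : ∀ {a k} {i : Fin n} → toℕ i ≢ k → monomial a k i ≈ 0#
  monomial-≢ {a} {k} {i} i≢k =
    reflexive (≡.cong (λ u → if u then a else 0#) (dec-false (toℕ i ℕ.≟ k) i≢k))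

  module WithSupport {i₀ : Fin n} (hi₀≉0 : ¬ h i₀ ≈ 0#) where

    s : ℕ
    s = toℕ i₀ % t

    s<t : s ℕ.< t
    s<t = m%n<n (toℕ i₀) t

    support-s : ∀ {i} → ¬ h i ≈ 0# → toℕ i % t ≡ s
    support-s hi≉0 = support-% h hi≉0 hi₀≉0

    φ-s : ∀ {α} → Fixed t α → φ (toℕ i₀) α ≈ φ s α
    φ-s fα = φ-% {t} fα (toℕ i₀)

    H-semilinear : ∀ {α} → Fixed t α → ∀ x → H (α * x) ≈ φ s α * H x
    H-semilinear fα x = trans (Fixed⇒scaling h hi₀≉0 fα x) (*-congʳ (φ-s fα))

    scaling-factor : ∀ {α β} → (∀ x → H (α * x) ≈ β * H x) → β ≈ φ s α
    scaling-factor scaling = trans (sym (scaling-coefficients h scaling hi₀≉0)) (φ-s (scaling⇒Fixed h scaling))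

    diagonalφ : Carrier → Mat₂
    diagonalφ α = diag α (φ s α)

    diagonalφ-cong : ∀ {α β} → α ≈ β → diagonalφ α Mat.≈ diagonalφ β
    diagonalφ-cong α≈β 0F 0F = α≈β
    diagonalφ-cong α≈β 0F 1F = refl
    diagonalφ-cong α≈β 1F 0F = refl
    diagonalφ-cong α≈β 1F 1F = φ-cong s α≈β

    diagonalφ∈G° : ∀ {α A} → Fixed t α → A Mat.≈ diagonalφ α → A ∈ G° h
    diagonalφ∈G° {α} {A} fα A≈ = Sum.[ zero-matrix , nonsingular ]′ (α ≉?0)
      where
      nonsingular : ¬ α ≈ 0# → A ∈ G° h
      nonsingular α≉0 = inj₁ (scaling∈G α≉0 (φ-≉0 s α≉0) (H-semilinear fα) A≈)
      zero-matrix : α ≈ 0# → A ∈ G° h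
      zero-matrix α≈0 = inj₂ (Mat.trans A≈ (Mat.trans (diagonalφ-cong α≈0) λ where
        0F 0F → refl
        0F 1F → refl
        1F 0F → refl
        1F 1F → φ-0 s))

    module AllDiagonal (diagonal : ∀ A → A ∈ G h → IsDiagonal A) where

      G°⇒diagonalφ : ∀ {A} → A ∈ G° h → Fixed t (A 0F 0F) × A Mat.≈ diagonalφ (A 0F 0F)
      G°⇒diagonalφ {A} (inj₁ A∈G) = scaling⇒Fixed h scaling , λ where
          0F 0F → refl
          0F 1F → diagonal A A∈G 0F 1F λ ()
          1F 0F → diagonal A A∈G 1F 0F λ ()
          1F 1F → scaling-factor scaling
        where scaling = diagonal-scaling A∈G (diagonal A A∈G)
      G°⇒diagonalφ {A} (inj₂ A≈0) = Fixed-resp t (sym (A≈0 0F 0F)) (φ-0 t) , λ where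
          0F 0F → refl
          0F 1F → A≈0 0F 1F
          1F 0F → A≈0 1F 0F
          1F 1F → trans (A≈0 1F 1F) (sym (trans (φ-cong s (A≈0 0F 0F)) (φ-0 s)))

      G°-size : HasSize (subsetoid matSetoid (G° h)) (q ℕ.^ t)
      G°-size = Composition.inverse {S = subsetoid setoid (Fixed t)} record
        { to        = λ (A , A∈) → A 0F 0F , proj₁ (G°⇒diagonalφ A∈)
        ; from      = λ (α , fα) → diagonalφ α , diagonalφ∈G° fα Mat.refl
        ; to-cong   = λ A≈B → A≈B 0F 0F
        ; from-cong = diagonalφ-cong
        ; inverse   = (λ A≈ → A≈ 0F 0F)
                    , (λ { {A , A∈} α≈ → Mat.trans (diagonalφ-cong α≈) (Mat.sym (proj₂ (G°⇒diagonalφ A∈))) })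
        } (Fixed-size (t∣n h) (0<t h))

      DiagonalField≐ : ∀ {s′} → s′ ≡ s → G° h ≐ DiagonalField t s′
      DiagonalField≐ ≡.refl =
        (λ A∈ → let fα , A≈ = G°⇒diagonalφ A∈ in _ , Fixed⇒𝔽 (t∣n h) (0<t h) fα , A≈) ,
        (λ (α , α∈ , A≈) → diagonalφ∈G° (𝔽⇒Fixed {t} α∈) A≈)

      -- Two enumerations of the same setoid give q^T = q^t, and q > 1.
      size-exponent : ∀ {T} → HasSize (subsetoid matSetoid (G° h)) (q ℕ.^ T) → T ≡ t
      size-exponent size = ℕ.≤-antisym
        (q^-cancel-≤ (size-≤ G°-setoid G°-setoid size G°-size id id))
        (q^-cancel-≤ (size-≤ G°-setoid G°-setoid G°-size size id id))
        where G°-setoid = subsetoid matSetoid (G° h)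

    -- The common residue of the exponents

    residue : ∀ {r} j → r ℕ.< t → (r ℕ.+ j ℕ.* t) % t ≡ r
    residue {r} j r<t = ≡.trans ([m+kn]%n≡m%n r j t) (m<n⇒m%n≡m r<t)

    -- All exponents in an expansion for r are congruent to r modulo t. If r differed from s, the
    -- coefficient at `i₀` would be 0.
    IsShift⇒≡s : ∀ {r} → IsShift h r → r ≡ s
    IsShift⇒≡s {r} (r<t , a , h≈) = decidable-stable (r ℕ.≟ s) λ r≢s → hi₀≉0
      (trans (h≈ i₀) (sum-≈ε +-commutativeMonoid {n / t} λ j → monomial-≢ {a j} {r ℕ.+ toℕ j ℕ.* t} {i₀} λ i₀≡ →
        r≢s (≡.sym (≡.trans (≡.cong (_% t) i₀≡) (residue (toℕ j) r<t)))))

    -- At an exponent i outside the residue class of s both sides vanish; inside it only the term j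
    -- = i / t contributes.
    s-IsShift : IsShift h s
    s-IsShift = s<t , a , expansion
      where
      exponent<n : ∀ (j : Fin (n / t)) → s ℕ.+ toℕ j ℕ.* t ℕ.< n
      exponent<n j = ℕ.<-≤-trans (ℕ.+-monoˡ-< (toℕ j ℕ.* t) s<t)
        (ℕ.≤-trans (ℕ.*-monoˡ-≤ t (Fin.toℕ<n j)) (m/n*n≤m n t))
      a : Fin (n / t) → Carrier
      a j = h (fromℕ< (exponent<n j))
      outside : ∀ i → toℕ i % t ≢ s → h i ≈ sum λ j → monomial (a j) (s ℕ.+ toℕ j ℕ.* t) i
      outside i i%t≢s = trans
        (decidable-stable (h i ≟ 0#) λ hi≉0 → i%t≢s (support-s hi≉0))
        (sym (sum-≈ε +-commutativeMonoid {n / t} λ j → monomial-≢ {a j} {s ℕ.+ toℕ j ℕ.* t} {i} λ i≡ →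
          i%t≢s (≡.trans (≡.cong (_% t) i≡) (residue (toℕ j) s<t))))
      inside : ∀ i → toℕ i % t ≡ s → h i ≈ sum λ j → monomial (a j) (s ℕ.+ toℕ j ℕ.* t) i
      inside i i%t≡s = sym (begin
          sum (λ j → monomial (a j) (s ℕ.+ toℕ j ℕ.* t) i)
            ≈⟨ sum-single +-commutativeMonoid {n / t} j₀ (λ j j≢j₀ →
                 monomial-≢ {a j} {s ℕ.+ toℕ j ℕ.* t} {i} λ i≡ → j≢j₀
                 (Fin.toℕ-injective (ℕ.*-cancelʳ-≡ (toℕ j) (toℕ j₀) t
                   (ℕ.+-cancelˡ-≡ s _ _ (≡.trans (≡.sym i≡) i≡s+j₀t))))) ⟩
          monomial (a j₀) (s ℕ.+ toℕ j₀ ℕ.* t) i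
            ≈⟨ monomial-≡ {a j₀} {s ℕ.+ toℕ j₀ ℕ.* t} {i} i≡s+j₀t ⟩
          h (fromℕ< (exponent<n j₀))
            ≡⟨ ≡.cong h (Fin.toℕ-injective (≡.trans (Fin.toℕ-fromℕ< (exponent<n j₀)) (≡.sym i≡s+j₀t))) ⟩
          h i ∎)
        where
        i/t<n/t : toℕ i / t ℕ.< n / t
        i/t<n/t = /-mono-< (Fin.toℕ<n i) (t∣n h)
        j₀ : Fin (n / t)
        j₀ = fromℕ< i/t<n/t
        i≡s+j₀t : toℕ i ≡ s ℕ.+ toℕ j₀ ℕ.* t
        i≡s+j₀t = ≡.trans (m≡m%n+[m/n]*n (toℕ i) t)
          (≡.cong₂ (λ r k → r ℕ.+ k ℕ.* t) i%t≡s (≡.sym (Fin.toℕ-fromℕ< i/t<n/t)))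
      expansion : ∀ i → h i ≈ sum λ j → monomial (a j) (s ℕ.+ toℕ j ℕ.* t) i
      expansion i = Sum.[ inside i , outside i ]′ (toSum (toℕ i % t ℕ.≟ s))

open import Data.Nat.Base using (_^_)

theorem4p3 : ∀ {c ℓ} (q n : ℕ) → IsPrimePower q → .{{_ : NonTrivial n}} →
    (F : FiniteField c ℓ (q ^ n)) →
    let open QPolynomials q n F in
    (h : QPoly) → Scattered h →
    ((∃ λ T → DiagonalStabilizer h T) → StandardForm h)
    × (n ≢ 2 → StandardForm h → ∃ λ T → DiagonalStabilizer h T)
    × (∀ T → DiagonalStabilizer h T → StandardForm h →
    T ≡ t h
    × ∃! _≡_ (λ s → IsShift h s)
    × (∀ s → IsShift h s → G° h ≐ DiagonalField T s))
theorem4p3 q n q-prime-power F h scattered =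
    (λ (T , 1<T , size , diagonal) → ≡.subst (1 ℕ.<_) (AllDiagonal.size-exponent diagonal size) 1<T)
  , (λ n≢2 standard →
       let open Semilinear (t∣n h) (0<t h) standard s<t H-semilinear scaling-factor
           diagonal = all-diagonal n≢2 in
       _ , standard , AllDiagonal.G°-size diagonal , diagonal)
  , (λ T (_ , size , diagonal) _ → let T≡t = AllDiagonal.size-exponent diagonal size in
       T≡t
     , (_ , s-IsShift , λ shift → ≡.sym (IsShift⇒≡s shift))
     , λ s shift → ≡.subst (λ T → G° h ≐ DiagonalField T s) (≡.sym T≡t)
         (AllDiagonal.DiagonalField≐ diagonal (IsShift⇒≡s shift)))
  where
  open QPolynomials q n F
  open QPolynomialProperties q n q-prime-power F
  open ScatteredPolynomial q n q-prime-power F h scattered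
  open WithSupport (proj₂ nonzero-coefficient)
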